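{- For each even integer $w\geqslant 4$ there is a partial Steiner triple system whose leave $L$ (a graph on $u$ vertices, say) satisfies all of the following conditions, and yet the graph $L\vee K_w$ has no $K_3$-decomposition: (1) $\deg_L(x)\equiv w \pmod 2$ for each vertex $x$ of $L$; (2) $u+w$ is odd if $w>0$; (3) $|E(L)|+uw+\binom{w}{2}\equiv 0\pmod 3$; (4) there is a subgraph $G$ of $L$ such that (i) $L-G$ has a $K_3$-decomposition, (ii) $w^2-(u+1)w+2|E(G)|\geqslant 0$, and (iii) $G$ is $w$-edge colourable.
   Context: A partial Steiner triple system $(U,\mathcal{A})$ consists of a finite set $U$ and a set $\mathcal{A}$ of 3-element subsets of $U$ such that any two elements of $U$ lie together in at most one triple. Its leave is the graph with vertex set $U$ whose edges are the pairs $xy$ not contained in any triple of $\mathcal{A}$. A $K_3$-decomposition of a graph is a set of triangles in it such that each edge lies in exactly one of them. For vertex-disjoint graphs $G,H$, $G\vee H$ is the graph on $V(G)\cup V(H)$ with edge set $E(G)\cup E(H)\cup\{xy: x\in V(G), y\in V(H)\}$; $K_w$ is the complete graph on $w$ new vertices. For graphs $G\subseteq L$, $L-G$ has vertex set $V(L)$ and edge set $E(L)\setminus E(G)$. Edge colourings are proper. -}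

module Defs where

open import Data.Fin using (Fin; _<?_; splitAt)
open import Data.Fin.Properties using (_≟_)
open import Data.Fin.Subset using (Subset; ∣_∣) renaming (_∈_ to _∈ₛ_)
open import Data.Fin.Subset.Properties using () renaming (_∈?_ to _∈ₛ?_)
open import Data.List using (List; length; filter; allFin; cartesianProduct)
open import Data.List.Membership.Propositional using (_∈_)
open import Data.List.Relation.Unary.All using (All)
open import Data.List.Relation.Unary.Any using (Any; any?)
open import Data.Nat using (ℕ; _+_)
open import Data.Product using (_×_; _,_; ∃!; ∃-syntax; proj₁; proj₂)
open import Data.Sum using (_⊎_; inj₁; inj₂)
open import Data.Unit using (⊤; tt)
open import Level using (0ℓ)
open import Relation.Binary using (Rel; Decidable; Symmetric; Irreflexive)
open import Relation.Binary.PropositionalEquality using (_≡_; _≢_; refl; ≢-sym)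
open import Relation.Nullary using (yes; ¬_; ¬?; _×-dec_)

record Graph (n : ℕ) : Set₁ where
  field
    Adj    : Rel (Fin n) 0ℓ
    adj?   : Decidable Adj
    symm   : Symmetric Adj
    irrefl : Irreflexive _≡_ Adj

open Graph public

deg : ∀ {n} → Graph n → Fin n → ℕ
deg G x = length (filter (adj? G x) (allFin _))

-- Each edge is counted once, through its representative (x , y) with x < y.
∣E_∣ : ∀ {n} → Graph n → ℕ
∣E_∣ {n} G =
  length (filter (λ p → (proj₁ p <? proj₂ p) ×-dec adj? G (proj₁ p) (proj₂ p))
                 (cartesianProduct (allFin n) (allFin n)))

-- Isolated vertices affect neither edge differences, edge counts nor edge
-- colourings, so subgraphs are taken to be spanning.
_⊆ᴳ_ : ∀ {n} → Graph n → Graph n → Set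
G ⊆ᴳ L = ∀ {x y} → Adj G x y → Adj L x y

_─_ : ∀ {n} → Graph n → Graph n → Graph n
L ─ G = record
  { Adj    = λ x y → Adj L x y × ¬ Adj G x y
  ; adj?   = λ x y → adj? L x y ×-dec ¬? (adj? G x y)
  ; symm   = λ (l , ¬g) → symm L l , λ g → ¬g (symm G g)
  ; irrefl = λ eq (l , _) → irrefl L eq l
  }

K : (w : ℕ) → Graph w
K w = record
  { Adj    = _≢_
  ; adj?   = λ x y → ¬? (x ≟ y)
  ; symm   = ≢-sym
  ; irrefl = λ eq neq → neq eq
  }

module _ {m n} (G : Graph m) (H : Graph n) where

  JoinAdj : Rel (Fin m ⊎ Fin n) 0ℓ
  JoinAdj (inj₁ x) (inj₁ y) = Adj G x y
  JoinAdj (inj₁ x) (inj₂ y) = ⊤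
  JoinAdj (inj₂ x) (inj₁ y) = ⊤
  JoinAdj (inj₂ x) (inj₂ y) = Adj H x y

  joinAdj? : Decidable JoinAdj
  joinAdj? (inj₁ x) (inj₁ y) = adj? G x y
  joinAdj? (inj₁ x) (inj₂ y) = yes tt
  joinAdj? (inj₂ x) (inj₁ y) = yes tt
  joinAdj? (inj₂ x) (inj₂ y) = adj? H x y

  joinSymm : Symmetric JoinAdj
  joinSymm {inj₁ x} {inj₁ y} = symm G
  joinSymm {inj₁ x} {inj₂ y} = λ _ → tt
  joinSymm {inj₂ x} {inj₁ y} = λ _ → tt
  joinSymm {inj₂ x} {inj₂ y} = symm H

  joinIrrefl : ∀ s → ¬ JoinAdj s s
  joinIrrefl (inj₁ x) = irrefl G refl
  joinIrrefl (inj₂ y) = irrefl H refl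

-- The first m elements of Fin (m + n) are the vertices of G, the remaining n
-- those of H.
_∨ᴳ_ : ∀ {m n} → Graph m → Graph n → Graph (m + n)
_∨ᴳ_ {m} G H = record
  { Adj    = λ x y → JoinAdj G H (splitAt m x) (splitAt m y)
  ; adj?   = λ x y → joinAdj? G H (splitAt m x) (splitAt m y)
  ; symm   = λ {x} {y} → joinSymm G H {splitAt m x} {splitAt m y}
  ; irrefl = λ { {x} refl → joinIrrefl G H (splitAt m x) }
  }

IsTriangle : ∀ {n} → Graph n → Subset n → Set
IsTriangle G t = ∣ t ∣ ≡ 3 × (∀ {x y} → x ∈ₛ t → y ∈ₛ t → x ≢ y → Adj G x y)

-- Finite sets of triples are lists used only through membership, so order and
-- repetitions are irrelevant; uniqueness is of the triple, not of its position.
IsK₃Decomposition : ∀ {n} → Graph n → List (Subset n) → Set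
IsK₃Decomposition G T =
  All (IsTriangle G) T ×
  (∀ x y → Adj G x y → ∃! _≡_ (λ t → t ∈ T × x ∈ₛ t × y ∈ₛ t))

HasK₃Decomposition : ∀ {n} → Graph n → Set
HasK₃Decomposition G = ∃[ T ] IsK₃Decomposition G T

-- The colour symmetry also makes the colour independent of the adjacency proof.
record EdgeColouring {n : ℕ} (G : Graph n) (k : ℕ) : Set where
  field
    colour      : ∀ {x y} → Adj G x y → Fin k
    colour-symm : ∀ {x y} (p : Adj G x y) (q : Adj G y x) → colour p ≡ colour q
    proper      : ∀ {x y z} (p : Adj G x y) (q : Adj G x z) →
                  y ≢ z → colour p ≢ colour q

record PartialSTS (u : ℕ) : Set where
  field
    triples : List (Subset u)
    size    : All (λ t → ∣ t ∣ ≡ 3) triples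
    unique  : ∀ {x y s t} → x ≢ y → s ∈ triples → t ∈ triples →
              x ∈ₛ s → y ∈ₛ s → x ∈ₛ t → y ∈ₛ t → s ≡ t

leave : ∀ {u} → PartialSTS u → Graph u
leave {u} P = record
  { Adj    = λ x y → x ≢ y × ¬ Covered x y
  ; adj?   = λ x y → ¬? (x ≟ y) ×-dec
                     ¬? (any? (λ t → (x ∈ₛ? t) ×-dec (y ∈ₛ? t)) triples)
  ; symm   = λ (x≢y , ¬c) → ≢-sym x≢y , λ c → ¬c (Any.map (λ (p , q) → q , p) c)
  ; irrefl = λ eq (x≢y , _) → x≢y eq
  }
  where
  open PartialSTS P
  import Data.List.Relation.Unary.Any as Any
  Covered : Rel (Fin u) 0ℓ
  Covered x y = Any (λ t → x ∈ₛ t × y ∈ₛ t) triples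

{-# OPTIONS --safe #-}
module Submission where

open import Data.Bool using (Bool; true; false; if_then_else_; _∧_; not)
open import Data.Bool.Properties using () renaming (_≟_ to _≟ᵇ_)
open import Data.Empty using (⊥-elim; ⊥)
open import Data.Fin
  using (Fin; zero; suc; punchOut; toℕ; punchIn; _↑ˡ_; _↑ʳ_; splitAt; fromℕ; combine; remQuot;
    inject≤; _<?_)
open import Data.Fin.Patterns
open import Data.Fin.Properties
  using (_≟_; any?; pigeonhole; <⇒≢; punchOut-injective; ¬∀⟶∃¬; punchIn-injective; punchInᵢ≢i;
    injective⇒≤; splitAt-↑ˡ; splitAt-↑ʳ; ↑ˡ-injective; ↑ʳ-injective; toℕ<n; toℕ-injective;
    toℕ-fromℕ; toℕ-fromℕ<)
open import Data.Fin.Subset using (Subset; ∣_∣; _∈_; _∉_; _∪_; ⁅_⁆; _-_; inside; outside)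
open import Data.Fin.Subset.Properties
  using (_∈?_; x∈⁅x⁆; x∈⁅y⁆⇒x≡y; x∈p∪q⁺; x∈p∪q⁻; ∪-comm; ∪-assoc; ∪-identityˡ; ∣⁅x⁆∣≡1;
    x∈p∧x≢y⇒x∈p-y; p─⊥≡p; p─q⊆p; nonempty?; Empty-unique; ∣⊥∣≡0)
open import Data.List
  using (List; map; filter; allFin; cartesianProduct; []; _∷_; _++_; length; tabulate)
open import Data.List.Membership.Propositional using (find; lose) renaming (_∈_ to _∈ˡ_)
open import Data.List.Membership.Propositional.Properties
  using (∈-map⁺; ∈-map⁻; ∈-filter⁺; ∈-filter⁻; ∈-cartesianProduct⁺; ∈-allFin; ∈-++⁺ˡ; ∈-++⁺ʳ;
    ∈-++⁻; ∈-cartesianProduct⁻)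
open import Data.List.Membership.Propositional.Properties.WithK using (unique∧set⇒bag)
open import Data.List.Relation.Binary.BagAndSetEquality using (∼bag⇒↭)
open import Data.List.Relation.Binary.Permutation.Propositional.Properties using (↭-length)
open import Data.List.Relation.Unary.All using (All; []; _∷_)
open import Data.List.Relation.Unary.AllPairs using ([]; _∷_)
open import Data.List.Relation.Unary.Any using (here; there) renaming (any? to anyˡ?)
open import Data.List.Relation.Unary.Unique.Propositional using (Unique)
open import Data.Maybe using (Maybe; just; nothing; _<∣>_)
open import Data.Maybe.Properties using (≡-dec; just-injective)
open import Data.Nat using (ℕ; zero; suc; _<_; s≤s; _+_; _*_; _%_; _/_; _≤_; _>_; z≤n)
open import Data.Nat.Combinatorics using (_C_; nC1≡n; nCk+nC[k+1]≡[n+1]C[k+1])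
open import Data.Nat.DivMod
  using (_mod_; m≡m%n+[m/n]*n; [m+kn]%n≡m%n; m<n⇒m%n≡m; m%n<n; m*n%n≡0; _divMod_; result)
open import Data.Nat.Divisibility using (_∣_; divides)
open import Data.Nat.ListAction using (sum)
open import Data.Nat.Tactic.RingSolver using (solve-∀)
open import Data.Product using (_×_; _,_; proj₁; proj₂; ∃-syntax; Σ-syntax)
open import Data.Sum using (_⊎_; inj₁; inj₂)
open import Data.Unit using (tt; ⊤)
open import Data.Vec using (_∷_; here; there; Vec; lookup; [])
open import Defs
open import Function using (_∘_; mk⇔; id)
open import Relation.Binary using (DecidableEquality)
open import Relation.Binary.PropositionalEquality
open import Relation.Nullary
  using (yes; no; contradiction; ¬_; Dec; _×-dec_; does; _⊎-dec_; ¬?; _→-dec_)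
open import Relation.Nullary.Decidable using (map′; toWitness)
open import Relation.Unary using (Decidable)
import Data.Fin as Fin
import Data.Fin.Properties as Fin
import Data.Integer as ℤ
import Data.Integer.Properties as ℤ
import Data.List.Properties as List
import Data.List.Relation.Unary.All as All
import Data.List.Relation.Unary.Unique.Propositional.Properties as Unique
import Data.Maybe as Maybe
import Data.Maybe.Properties as Maybe
import Data.Nat.Properties as ℕ
import Data.Product.Properties as Product
import Data.Sum.Properties as Sum

-- Let N = w + 1.  The leave contains a bipartite component S on A ∪ B,
-- |A| = |B| = N, in which all vertices have degree w except one a ∈ A and one
-- b ∈ B of degree w − 2.  In a K₃-decomposition of L ∨ K w each edge of S lies
-- in a triangle with a vertex of K w, its colour, and every vertex of degree w
-- sees all w colours.  Counting the edges of one colour from both sides, a and b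
-- miss the same two colours c, d; but then both acd and bcd are triangles
-- although the edge cd lies in only one.
--
-- The points are (x , i) with x ∈ ℤ/N and i one of six levels, together with s
-- further points, the hubs.  As in Bose's construction, the base system has the
-- triples {(x , i) , (y , i) , ((x + y) / 2 , i + 1)}, similar transversal triples
-- on the levels 0, 2, 4 and on 1, 3, 5, and for each x the same small system on
-- the points (x , i) and the hubs.  Its leave is, between levels i and i + 3,
-- complete bipartite minus a perfect matching, hence w-regular.  Exchanging
-- finitely many triples on the positions 0, 1, −1 and the hubs, in a way that
-- does not depend on N, makes it the graph S with a and b at position 0.

-- The subgraph `G` is taken to be the whole leave `L`. Then `L ─ G` has no edges, and what is
-- needed is an `L` with enough edges, with a proper colouring in w colours, and with the graph S
-- above as a part that no other edge of `L` meets.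
--
-- Obstruction (`noDecomposition`): S is bipartite, so no triangle lies in it, and a decomposition
-- colours its edges properly by vertices of `K w`. A colour that reaches b reaches every vertex of
-- B, hence, being a matching and by |A| = |B|, every vertex of A. So a colour c missing at a is
-- missing at b. The triangle on the edge from a to c then has its third vertex d in `K w`, and d is
-- missing at a and b too. As b misses at most two colours, its triangle at c also ends in d, and
-- two triangles share the edge cd.
--
-- Construction: a partial Steiner system is handled as the partial operation giving the third point
-- of a triple. Overriding the base operation on finitely many pairs keeps its laws provided that
-- each base triple is given up at all of its pairs or at none. This condition involves only the
-- positions 0, 1, -1 and the hubs, so one finite check serves every N. The leave is then known
-- exactly (`op-free⁻`, `op-free⁺`): three bipartite graphs between opposite levels, plain or
-- twisted, and some pairs of hubs.
--
-- Colouring: a plain graph is coloured by differences modulo N, and twisting disturbs only the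
-- differences 1 and -1. The hub graph needs at most four colours, which is where w ≥ 4 enters.
--
-- Numbers: a plain graph has w(w + 1) edges, a twisted one w(w + 1) - 2. For `seed₁` the left side
-- of (ii) is w² - 2w - 12, and for `seed₅` it is (w - 2)(w - 4). The number of hubs is odd, all
-- degrees are even, and the residue of w modulo 3 decides which seed satisfies (3).

∣p∣≡1+∣p-x∣ : ∀ {n} {p : Subset n} {x} → x ∈ p → ∣ p ∣ ≡ suc ∣ p - x ∣
∣p∣≡1+∣p-x∣ {p = inside ∷ p} {zero} here = cong (λ q → suc ∣ q ∣) (sym (p─⊥≡p p))
∣p∣≡1+∣p-x∣ {p = inside ∷ p} {suc x} (there x∈p) = cong suc (∣p∣≡1+∣p-x∣ x∈p)
∣p∣≡1+∣p-x∣ {p = outside ∷ p} {suc x} (there x∈p) = ∣p∣≡1+∣p-x∣ x∈p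

x∉p⇒∣⁅x⁆∪p∣ : ∀ {n} {p : Subset n} {x} → x ∉ p → ∣ ⁅ x ⁆ ∪ p ∣ ≡ suc ∣ p ∣
x∉p⇒∣⁅x⁆∪p∣ {p = inside ∷ p} {zero} x∉p = contradiction here x∉p
x∉p⇒∣⁅x⁆∪p∣ {p = outside ∷ p} {zero} x∉p = cong (λ q → suc ∣ q ∣) (∪-identityˡ p)
x∉p⇒∣⁅x⁆∪p∣ {p = inside ∷ p} {suc x} x∉p = cong suc (x∉p⇒∣⁅x⁆∪p∣ (x∉p ∘ there))
x∉p⇒∣⁅x⁆∪p∣ {p = outside ∷ p} {suc x} x∉p = x∉p⇒∣⁅x⁆∪p∣ (x∉p ∘ there)

x∉p-x : ∀ {n} (p : Subset n) x → x ∉ p - x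
x∉p-x (b ∷ p) (suc x) (there q) = x∉p-x p x q

-- Removing x and y leaves a subset of size one.
thirdElement : ∀ {n} {t : Subset n} {x y} → ∣ t ∣ ≡ 3 → x ∈ t → y ∈ t → x ≢ y →
               ∃[ z ] z ∈ t × z ≢ x × z ≢ y × (∀ {v} → v ∈ t → v ≢ x → v ≢ y → v ≡ z)
thirdElement {n} {t} {x} {y} size x∈t y∈t x≢y with nonempty? (t - x - y)
... | no empty = contradiction
  (trans (trans (sym size) (trans (∣p∣≡1+∣p-x∣ x∈t) (cong suc (∣p∣≡1+∣p-x∣ y∈t-x))))
         (cong (λ q → suc (suc q)) (trans (cong ∣_∣ (Empty-unique empty)) (∣⊥∣≡0 n))))
  λ ()
  where y∈t-x = x∈p∧x≢y⇒x∈p-y y∈t (x≢y ∘ sym)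
... | yes (z , z∈t-x-y) = z , p─q⊆p t _ z∈t-x , z≢x , z≢y , only
  where
  y∈t-x = x∈p∧x≢y⇒x∈p-y y∈t (x≢y ∘ sym)
  z∈t-x = p─q⊆p (t - x) _ z∈t-x-y
  z≢x : z ≢ x
  z≢x refl = x∉p-x t x z∈t-x
  z≢y : z ≢ y
  z≢y refl = x∉p-x (t - x) y z∈t-x-y
  ∣t-x-y∣≡1 : ∣ t - x - y ∣ ≡ 1
  ∣t-x-y∣≡1 = ℕ.suc-injective (ℕ.suc-injective
    (trans (sym (trans (∣p∣≡1+∣p-x∣ x∈t) (cong suc (∣p∣≡1+∣p-x∣ y∈t-x)))) size))
  only : ∀ {v} → v ∈ t → v ≢ x → v ≢ y → v ≡ z
  only {v} v∈t v≢x v≢y with v ≟ z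
  ... | yes v≡z = v≡z
  ... | no v≢z = contradiction
    (trans (ℕ.suc-injective (trans (sym ∣t-x-y∣≡1) (∣p∣≡1+∣p-x∣ z∈t-x-y)))
      (∣p∣≡1+∣p-x∣ (x∈p∧x≢y⇒x∈p-y (x∈p∧x≢y⇒x∈p-y (x∈p∧x≢y⇒x∈p-y v∈t v≢x) v≢y) v≢z)))
    λ ()

module _ {n : ℕ} where

  triple : (x y z : Fin n) → Subset n
  triple x y z = ⁅ x ⁆ ∪ (⁅ y ⁆ ∪ ⁅ z ⁆)

  ∈-triple⁻ : ∀ {v x y z} → v ∈ triple x y z → v ≡ x ⊎ v ≡ y ⊎ v ≡ z
  ∈-triple⁻ {v} {x} {y} {z} v∈ with x∈p∪q⁻ ⁅ x ⁆ _ v∈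
  ... | inj₁ p = inj₁ (x∈⁅y⁆⇒x≡y _ p)
  ... | inj₂ q with x∈p∪q⁻ ⁅ y ⁆ _ q
  ...   | inj₁ p = inj₂ (inj₁ (x∈⁅y⁆⇒x≡y _ p))
  ...   | inj₂ p = inj₂ (inj₂ (x∈⁅y⁆⇒x≡y _ p))

  first∈triple : ∀ x y z → x ∈ triple x y z
  first∈triple x y z = x∈p∪q⁺ (inj₁ (x∈⁅x⁆ x))

  second∈triple : ∀ x y z → y ∈ triple x y z
  second∈triple x y z = x∈p∪q⁺ {p = ⁅ x ⁆} (inj₂ (x∈p∪q⁺ (inj₁ (x∈⁅x⁆ y))))

  triple-swapʳ : ∀ x y z → triple x y z ≡ triple x z y
  triple-swapʳ x y z = cong (⁅ x ⁆ ∪_) (∪-comm ⁅ y ⁆ ⁅ z ⁆)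

  triple-swapˡ : ∀ x y z → triple x y z ≡ triple y x z
  triple-swapˡ x y z = begin
    ⁅ x ⁆ ∪ (⁅ y ⁆ ∪ ⁅ z ⁆) ≡⟨ ∪-assoc ⁅ x ⁆ ⁅ y ⁆ ⁅ z ⁆ ⟨
    (⁅ x ⁆ ∪ ⁅ y ⁆) ∪ ⁅ z ⁆ ≡⟨ cong (_∪ ⁅ z ⁆) (∪-comm ⁅ x ⁆ ⁅ y ⁆) ⟩
    (⁅ y ⁆ ∪ ⁅ x ⁆) ∪ ⁅ z ⁆ ≡⟨ ∪-assoc ⁅ y ⁆ ⁅ x ⁆ ⁅ z ⁆ ⟩
    ⁅ y ⁆ ∪ (⁅ x ⁆ ∪ ⁅ z ⁆) ∎
    where open ≡-Reasoning

  ∣triple∣≡3 : ∀ {x y z} → x ≢ y → x ≢ z → y ≢ z → ∣ triple x y z ∣ ≡ 3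
  ∣triple∣≡3 {x} {y} {z} x≢y x≢z y≢z = begin
    ∣ ⁅ x ⁆ ∪ (⁅ y ⁆ ∪ ⁅ z ⁆) ∣ ≡⟨ x∉p⇒∣⁅x⁆∪p∣ x∉ ⟩
    suc ∣ ⁅ y ⁆ ∪ ⁅ z ⁆ ∣       ≡⟨ cong suc (x∉p⇒∣⁅x⁆∪p∣ (y≢z ∘ x∈⁅y⁆⇒x≡y _)) ⟩
    suc (suc ∣ ⁅ z ⁆ ∣)         ≡⟨ cong (λ m → suc (suc m)) (∣⁅x⁆∣≡1 z) ⟩
    3                           ∎
    where
    open ≡-Reasoning
    x∉ : x ∉ ⁅ y ⁆ ∪ ⁅ z ⁆
    x∉ p with x∈p∪q⁻ ⁅ y ⁆ _ p
    ... | inj₁ q = x≢y (x∈⁅y⁆⇒x≡y _ q)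
    ... | inj₂ q = x≢z (x∈⁅y⁆⇒x≡y _ q)

-- If k were missed, punching it out would inject a finite set into a smaller one.
injective⇒surjective : ∀ {n} (f : Fin n → Fin n) → (∀ {i j} → f i ≡ f j → i ≡ j) →
                       ∀ k → ∃[ i ] f i ≡ k
injective⇒surjective {suc n} f inj k with any? (λ i → f i ≟ k)
... | yes hit = hit
... | no miss = let i , j , i<j , eq = pigeonhole ℕ.≤-refl (λ i → punchOut (miss′ i)) in
  contradiction (inj (punchOut-injective (miss′ i) (miss′ j) eq)) (<⇒≢ i<j)
  where
  miss′ : ∀ i → k ≢ f i
  miss′ i eq = miss (i , sym eq)

-- Partial Steiner triple systems from partial operations

-- A partial Steiner triple system as its partial operation "third point of the
-- triple through x and y".
record PartialSteiner {A : Set} (op : A → A → Maybe A) : Set where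
  field
    op-comm  : ∀ {x y z} → op x y ≡ just z → op y x ≡ just z
    op-swap  : ∀ {x y z} → op x y ≡ just z → op x z ≡ just y
    op-diag  : ∀ x → op x x ≡ nothing

  op-≢₁₂ : ∀ {x y z} → op x y ≡ just z → x ≢ y
  op-≢₁₂ {x} eq refl with trans (sym (op-diag x)) eq
  ... | ()

  op-≢₁₃ : ∀ {x y z} → op x y ≡ just z → x ≢ z
  op-≢₁₃ = op-≢₁₂ ∘ op-swap

  op-≢₂₃ : ∀ {x y z} → op x y ≡ just z → y ≢ z
  op-≢₂₃ = op-≢₁₃ ∘ op-comm

module Blocks {u : ℕ} {op : Fin u → Fin u → Maybe (Fin u)} (isPS : PartialSteiner op) where
  open PartialSteiner isPS

  private
    Block : Fin u × Fin u × Fin u → Set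
    Block (x , y , z) = op x y ≡ just z

    block? : Decidable Block
    block? (x , y , z) = ≡-dec _≟_ (op x y) (just z)

    toTriple : Fin u × Fin u × Fin u → Subset u
    toTriple (x , y , z) = triple x y z

    candidates : List (Fin u × Fin u × Fin u)
    candidates = cartesianProduct (allFin u) (cartesianProduct (allFin u) (allFin u))

  -- Each triple is listed once for every ordering of its points, which is harmless since only
  -- membership counts.
  blocks : List (Subset u)
  blocks = map toTriple (filter block? candidates)

  ∈-blocks⁺ : ∀ {x y z} → op x y ≡ just z → triple x y z ∈ˡ blocks
  ∈-blocks⁺ {x} {y} {z} eq = ∈-map⁺ toTriple
    (∈-filter⁺ block? (∈-cartesianProduct⁺ (∈-allFin x) (∈-cartesianProduct⁺ (∈-allFin y) (∈-allFin z))) eq)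

  ∈-blocks⁻ : ∀ {t} → t ∈ˡ blocks → ∃[ x ] ∃[ y ] ∃[ z ] op x y ≡ just z × t ≡ triple x y z
  ∈-blocks⁻ t∈ = let (x , y , z) , xyz∈ , eq = ∈-map⁻ toTriple t∈ in
    x , y , z , proj₂ (∈-filter⁻ block? {xs = candidates} xyz∈) , eq

  -- The laws of `op` are invariant under reordering a triple, so any two of its points may serve as
  -- arguments. Uniqueness of the triple through two points is then single-valuedness of `op`.
  block-through : ∀ {t p q} → t ∈ˡ blocks → p ∈ t → q ∈ t → p ≢ q →
                  ∃[ r ] op p q ≡ just r × t ≡ triple p q r
  block-through t∈ p∈t q∈t p≢q with ∈-blocks⁻ t∈
  ... | x , y , z , eq , refl with ∈-triple⁻ p∈t | ∈-triple⁻ q∈t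
  ... | inj₁ refl        | inj₁ refl        = contradiction refl p≢q
  ... | inj₁ refl        | inj₂ (inj₁ refl) = z , eq , refl
  ... | inj₁ refl        | inj₂ (inj₂ refl) = y , op-swap eq , triple-swapʳ x y z
  ... | inj₂ (inj₁ refl) | inj₁ refl        = z , op-comm eq , triple-swapˡ x y z
  ... | inj₂ (inj₁ refl) | inj₂ (inj₁ refl) = contradiction refl p≢q
  ... | inj₂ (inj₁ refl) | inj₂ (inj₂ refl) =
    x , op-swap (op-comm eq) , trans (triple-swapˡ x y z) (triple-swapʳ y x z)
  ... | inj₂ (inj₂ refl) | inj₁ refl        =
    y , op-comm (op-swap eq) , trans (triple-swapʳ x y z) (triple-swapˡ x z y)
  ... | inj₂ (inj₂ refl) | inj₂ (inj₁ refl) =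
    x , op-comm (op-swap (op-comm eq)) ,
    trans (triple-swapˡ x y z) (trans (triple-swapʳ y x z) (triple-swapˡ y z x))
  ... | inj₂ (inj₂ refl) | inj₂ (inj₂ refl) = contradiction refl p≢q

  system : PartialSTS u
  system = record
    { triples = blocks
    ; size    = All.tabulate λ t∈ → let _ , _ , _ , eq , t≡ = ∈-blocks⁻ t∈ in
                trans (cong ∣_∣ t≡) (∣triple∣≡3 (op-≢₁₂ eq) (op-≢₁₃ eq) (op-≢₂₃ eq))
    ; unique  = λ x≢y s∈ t∈ x∈s y∈s x∈t y∈t →
                let r , eqr , s≡ = block-through s∈ x∈s y∈s x≢y
                    r′ , eqr′ , t≡ = block-through t∈ x∈t y∈t x≢y
                in trans s≡ (trans (cong (triple _ _) (just-injective (trans (sym eqr) eqr′))) (sym t≡))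
    }

  leave-adj⁻ : ∀ {x y} → Adj (leave system) x y → x ≢ y × op x y ≡ nothing
  leave-adj⁻ {x} {y} (x≢y , ¬covered) with op x y in eq
  ... | nothing = x≢y , refl
  ... | just z = ⊥-elim (¬covered (lose (∈-blocks⁺ eq) (first∈triple x y z , second∈triple x y z)))

  leave-adj⁺ : ∀ {x y} → x ≢ y → op x y ≡ nothing → Adj (leave system) x y
  leave-adj⁺ x≢y none = x≢y , λ covered →
    let _ , t∈ , x∈t , y∈t = find covered
        _ , eq , _ = block-through t∈ x∈t y∈t x≢y
    in contradiction (trans (sym none) eq) λ ()

-- The obstruction to a decomposition

module Decomposition {n : ℕ} (G : Graph n) (T : List (Subset n)) (isDec : IsK₃Decomposition G T) where

  Tri : Fin n → Fin n → Fin n → Set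
  Tri a b c = ∃[ t ] t ∈ˡ T × a ∈ t × b ∈ t × c ∈ t

  tri? : ∀ a b c → Dec (Tri a b c)
  tri? a b c with anyˡ? (λ t → (a ∈? t) ×-dec (b ∈? t) ×-dec (c ∈? t)) T
  ... | yes found = yes (find found)
  ... | no none = no λ (t , t∈ , abc) → none (lose t∈ abc)

  tri-swapˡ : ∀ {a b c} → Tri a b c → Tri b a c
  tri-swapˡ (t , t∈ , a∈ , b∈ , c∈) = t , t∈ , b∈ , a∈ , c∈

  tri-swapʳ : ∀ {a b c} → Tri a b c → Tri a c b
  tri-swapʳ (t , t∈ , a∈ , b∈ , c∈) = t , t∈ , a∈ , c∈ , b∈

  tri-adj : ∀ {a b c} → Tri a b c → a ≢ b → Adj G a b
  tri-adj (t , t∈ , a∈ , b∈ , _) = proj₂ (All.lookup (proj₁ isDec) t∈) a∈ b∈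

  tri-unique : ∀ {a b c d} → a ≢ b → Tri a b c → Tri a b d →
               c ≢ a → c ≢ b → d ≢ a → d ≢ b → c ≡ d
  tri-unique {a} {b} a≢b abc@(s , s∈ , as , bs , cs) (t , t∈ , at , bt , dt) c≢a c≢b d≢a d≢b
    with proj₂ isDec a b (tri-adj abc a≢b)
  ... | r , _ , uniq with trans (sym (uniq (s∈ , as , bs))) (uniq (t∈ , at , bt))
  ... | refl =
    let z , _ , _ , _ , only = thirdElement (proj₁ (All.lookup (proj₁ isDec) s∈)) as bs a≢b
    in trans (only cs c≢a c≢b) (sym (only dt d≢a d≢b))

  third : ∀ {a b} → Adj G a b → ∃[ c ] Tri a b c × c ≢ a × c ≢ b × Adj G a c × Adj G b c
  third {a} {b} ab with proj₂ isDec a b ab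
  ... | t , (t∈ , a∈ , b∈) , _ =
    let size , clique = All.lookup (proj₁ isDec) t∈
        z , z∈ , z≢a , z≢b , _ = thirdElement size a∈ b∈ λ a≡b → irrefl G a≡b ab
    in z , (t , t∈ , a∈ , b∈ , z∈) , z≢a , z≢b , clique a∈ z∈ (z≢a ∘ sym) , clique b∈ z∈ (z≢b ∘ sym)

module JoinWithClique {u : ℕ} (L : Graph u) (w : ℕ) where

  base : Fin u → Fin (u + w)
  base = _↑ˡ w

  apex : Fin w → Fin (u + w)
  apex = u ↑ʳ_

  data View : Fin (u + w) → Set where
    isBase : ∀ x → View (base x)
    isApex : ∀ c → View (apex c)

  view : ∀ z → View z
  view z with splitAt u z in eq
  ... | inj₁ x = subst View (Fin.splitAt⁻¹-↑ˡ eq) (isBase x)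
  ... | inj₂ c = subst View (Fin.splitAt⁻¹-↑ʳ eq) (isApex c)

  base≢apex : ∀ {x c} → base x ≢ apex c
  base≢apex {x} {c} eq with trans (sym (splitAt-↑ˡ u x w)) (trans (cong (splitAt u) eq) (splitAt-↑ʳ u w c))
  ... | ()

  base-injective : ∀ {x y} → base x ≡ base y → x ≡ y
  base-injective = ↑ˡ-injective w _ _

  apex-injective : ∀ {c d} → apex c ≡ apex d → c ≡ d
  apex-injective = ↑ʳ-injective u _ _

  base-adj⁻ : ∀ {x y} → Adj (L ∨ᴳ K w) (base x) (base y) → Adj L x y
  base-adj⁻ {x} {y} = subst₂ (JoinAdj L (K w)) (splitAt-↑ˡ u x w) (splitAt-↑ˡ u y w)

  base-adj⁺ : ∀ {x y} → Adj L x y → Adj (L ∨ᴳ K w) (base x) (base y)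
  base-adj⁺ {x} {y} = subst₂ (JoinAdj L (K w)) (sym (splitAt-↑ˡ u x w)) (sym (splitAt-↑ˡ u y w))

  cross-adj : ∀ x c → Adj (L ∨ᴳ K w) (base x) (apex c)
  cross-adj x c = subst₂ (JoinAdj L (K w)) (sym (splitAt-↑ˡ u x w)) (sym (splitAt-↑ʳ u w c)) tt

-- In a K₃-decomposition of L ∨ K w, assign to each edge A x – B y of L the
-- vertex of K w in its triangle: at A x (x ≢ o) and B y (y ≢ o) all w colours
-- occur.  The sides having equal size, a colour missing at A o is missing at
-- B o.  As B o misses at most two colours, the triangles of A o and B o
-- at such a colour share an edge of K w.
module Obstruction
  {u w : ℕ} (L : Graph u) (A B : Fin (suc w) → Fin u) (E : Fin (suc w) → Fin (suc w) → Set)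
  (A-injective : ∀ {x y} → A x ≡ A y → x ≡ y)
  (B-injective : ∀ {x y} → B x ≡ B y → x ≡ y)
  (A≢B : ∀ {x y} → A x ≢ B y)
  (adj-A : ∀ {x v} → Adj L (A x) v → ∃[ y ] v ≡ B y × E x y)
  (adj-B : ∀ {y v} → Adj L (B y) v → ∃[ x ] v ≡ A x × E x y)
  (adj-AB : ∀ {x y} → E x y → Adj L (A x) (B y))
  (o p q : Fin (suc w)) (o≢p : o ≢ p)
  (row : ∀ x → x ≢ o → ∃[ f ] (∀ y → y ≢ f → E x y))
  (col : ∀ y → y ≢ o → ∃[ f ] (∀ x → x ≢ f → E x y))
  (row-o : ∀ {y} → E o y → y ≢ o × y ≢ p)
  (col-o : ∀ x → x ≢ o → x ≢ p → x ≢ q → E x o)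
  where

  open JoinWithClique L w

  module _ (T : List (Subset (u + w))) (isDec : IsK₃Decomposition (L ∨ᴳ K w) T) where
    open Decomposition (L ∨ᴳ K w) T isDec

    Coloured : Fin (suc w) → Fin (suc w) → Fin w → Set
    Coloured x y c = Tri (base (A x)) (base (B y)) (apex c)

    coloured⇒E : ∀ {x y c} → Coloured x y c → E x y
    coloured⇒E xyc with adj-A (base-adj⁻ (tri-adj xyc (A≢B ∘ base-injective)))
    ... | y′ , By≡ , e with refl ← B-injective By≡ = e

    edge-coloured : ∀ {x y} → E x y → ∃[ c ] Coloured x y c
    edge-coloured e with third (base-adj⁺ (adj-AB e))
    ... | z , xyz , _ , _ , xz , yz with view z
    ... | isApex c = c , xyz
    -- A triangle inside L is impossible: its third vertex would lie both in B, as a neighbour of A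
    -- x, and in A, as a neighbour of B y.
    ... | isBase v with adj-A (base-adj⁻ xz) | adj-B (base-adj⁻ yz)
    ... | _ , v≡B , _ | _ , v≡A , _ = contradiction (trans (sym v≡A) v≡B) A≢B

    colour-unique : ∀ {x y c d} → Coloured x y c → Coloured x y d → c ≡ d
    colour-unique s t = apex-injective (tri-unique (A≢B ∘ base-injective) s t
      (base≢apex ∘ sym) (base≢apex ∘ sym) (base≢apex ∘ sym) (base≢apex ∘ sym))

    column-unique : ∀ {x y z c} → Coloured x y c → Coloured x z c → y ≡ z
    column-unique s t = B-injective (base-injective (tri-unique base≢apex (tri-swapʳ s) (tri-swapʳ t)
      (A≢B ∘ sym ∘ base-injective) base≢apex (A≢B ∘ sym ∘ base-injective) base≢apex))

    row-unique : ∀ {x y z c} → Coloured x z c → Coloured y z c → x ≡ y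
    row-unique s t = A-injective (base-injective (tri-unique base≢apex
      (tri-swapʳ (tri-swapˡ s)) (tri-swapʳ (tri-swapˡ t))
      (A≢B ∘ base-injective) base≢apex (A≢B ∘ base-injective) base≢apex))

    -- The w neighbours of B y have distinct colours, so they use all w of them.
    column-full : ∀ y → y ≢ o → ∀ c → ∃[ x ] Coloured x y c
    column-full y y≢o c =
      let j , eq = injective⇒surjective colour injective c
      in punchIn f j , subst (Coloured _ y) eq (proj₂ (edge j))
      where
      f = proj₁ (col y y≢o)
      edge : ∀ j → ∃[ c ] Coloured (punchIn f j) y c
      edge j = edge-coloured (proj₂ (col y y≢o) (punchIn f j) (punchInᵢ≢i f j))
      colour = proj₁ ∘ edge
      injective : ∀ {i j} → colour i ≡ colour j → i ≡ j
      injective {i} {j} eq = punchIn-injective f i j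
        (row-unique (subst (Coloured _ y) eq (proj₂ (edge i))) (proj₂ (edge j)))

    MissingA MissingB : Fin w → Set
    MissingA c = ¬ (∃[ y ] Coloured o y c)
    MissingB c = ¬ (∃[ x ] Coloured x o c)

    -- If all w colours occurred at A o, their other ends together with the position o would be w +
    -- 1 distinct positions, none of them p.
    missingAt-A : ∃[ c ] MissingA c
    missingAt-A = ¬∀⟶∃¬ w _ (λ c → any? λ y → tri? _ _ _) λ full →
      let open Full full in p-missed (injective⇒surjective g g-injective p)
      where
      module Full (full : ∀ c → ∃[ y ] Coloured o y c) where
        g : Fin (suc w) → Fin (suc w)
        g zero    = o
        g (suc c) = proj₁ (full c)
        avoids : ∀ c → g (suc c) ≢ o × g (suc c) ≢ p
        avoids c = row-o (coloured⇒E (proj₂ (full c)))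
        g-injective : ∀ {i j} → g i ≡ g j → i ≡ j
        g-injective {zero}  {zero}  _  = refl
        g-injective {zero}  {suc c} eq = contradiction (sym eq) (proj₁ (avoids c))
        g-injective {suc c} {zero}  eq = contradiction eq (proj₁ (avoids c))
        g-injective {suc c} {suc d} eq = cong suc (colour-unique
          (proj₂ (full c)) (subst (λ y → Coloured o y d) (sym eq) (proj₂ (full d))))
        p-missed : ¬ (∃[ i ] g i ≡ p)
        p-missed (zero  , eq) = o≢p eq
        p-missed (suc c , eq) = proj₂ (avoids c) eq

    -- Were c present at B o, it would be present at all w + 1 vertices of B. Its edges form a
    -- matching, so they would also cover all w + 1 vertices of A, including A o.
    missing-transfer : ∀ {c} → MissingA c → MissingB c
    missing-transfer {c} missing (x₀ , e₀) =
      let y , eq = injective⇒surjective (proj₁ ∘ partner) injective o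
      in missing (y , subst (λ x → Coloured x y c) eq (proj₂ (partner y)))
      where
      partner : ∀ y → ∃[ x ] Coloured x y c
      partner y with y ≟ o
      ... | yes refl = x₀ , e₀
      ... | no y≢o = column-full y y≢o c
      injective : ∀ {i j} → proj₁ (partner i) ≡ proj₁ (partner j) → i ≡ j
      injective {i} {j} eq = column-unique
        (subst (λ x → Coloured x i c) eq (proj₂ (partner i))) (proj₂ (partner j))

    -- The triangle on the edge from A o to c cannot use an edge of S, so it ends in a further
    -- vertex d of `K w`. It also uses up the edge from A o to d, so d colours no edge at A o.
    mateA : ∀ {c} → MissingA c → ∃[ d ] c ≢ d × Tri (base (A o)) (apex c) (apex d) × MissingA d
    mateA {c} missing with third (cross-adj (A o) c)
    ... | z , t , z≢o , z≢c , oz , _ with view z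
    ... | isBase v with adj-A (base-adj⁻ oz)
    ...   | y , refl , _ = contradiction (y , tri-swapʳ t) missing
    mateA {c} missing | z , t , z≢o , z≢c , oz , _ | isApex d =
      d , (λ eq → z≢c (cong apex (sym eq))) , t , λ (y , e) →
        contradiction (tri-unique base≢apex (tri-swapʳ e) (tri-swapʳ t)
          (A≢B ∘ sym ∘ base-injective) base≢apex (base≢apex ∘ sym) (z≢c ∘ sym)) base≢apex

    mateB : ∀ {c} → MissingB c → ∃[ d ] c ≢ d × Tri (base (B o)) (apex c) (apex d) × MissingB d
    mateB {c} missing with third (cross-adj (B o) c)
    ... | z , t , z≢o , z≢c , oz , _ with view z
    ... | isBase v with adj-B (base-adj⁻ oz)
    ...   | y , refl , _ = contradiction (y , tri-swapˡ (tri-swapʳ t)) missing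
    mateB {c} missing | z , t , z≢o , z≢c , oz , _ | isApex d =
      d , (λ eq → z≢c (cong apex (sym eq))) , t , λ (y , e) →
        contradiction (tri-unique base≢apex (tri-swapʳ (tri-swapˡ e)) (tri-swapʳ t)
          (A≢B ∘ base-injective) base≢apex (base≢apex ∘ sym) (z≢c ∘ sym)) base≢apex

    -- B o is adjacent to every position outside o, p, q. Assigning three missing colours to these
    -- and the edge colours to the rest would inject w + 1 positions into w colours.
    noThreeMissing : ∀ {c d e} → MissingB c → MissingB d → MissingB e → c ≢ d → c ≢ e → ¬ d ≢ e
    noThreeMissing {c} {d} {e} mc md me c≢d c≢e d≢e = ℕ.1+n≰n (injective⇒≤ {f = colour} injective)
      where
      data Position : Fin (suc w) → Set where
        at-o : Position o
        at-p : Position p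
        at-q : Position q
        else : ∀ {x} c → Coloured x o c → Position x
      position : ∀ x → Position x
      position x with x ≟ o | x ≟ p | x ≟ q
      ... | yes refl | _        | _        = at-o
      ... | no _     | yes refl | _        = at-p
      ... | no _     | no _     | yes refl = at-q
      ... | no x≢o   | no x≢p   | no x≢q   = let c , s = edge-coloured (col-o x x≢o x≢p x≢q) in else c s
      colourOf : ∀ {x} → Position x → Fin w
      colourOf at-o = c
      colourOf at-p = d
      colourOf at-q = e
      colourOf (else c _) = c
      colourOf-injective : ∀ {x y} (i : Position x) (j : Position y) → colourOf i ≡ colourOf j → x ≡ y
      colourOf-injective at-o at-o eq = refl
      colourOf-injective at-o at-p eq = contradiction eq c≢d
      colourOf-injective at-o at-q eq = contradiction eq c≢e
      colourOf-injective at-p at-o eq = contradiction (sym eq) c≢d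
      colourOf-injective at-p at-p eq = refl
      colourOf-injective at-p at-q eq = contradiction eq d≢e
      colourOf-injective at-q at-o eq = contradiction (sym eq) c≢e
      colourOf-injective at-q at-p eq = contradiction (sym eq) d≢e
      colourOf-injective at-q at-q eq = refl
      colourOf-injective at-o (else _ s) refl = contradiction (_ , s) mc
      colourOf-injective at-p (else _ s) refl = contradiction (_ , s) md
      colourOf-injective at-q (else _ s) refl = contradiction (_ , s) me
      colourOf-injective (else _ s) at-o refl = contradiction (_ , s) mc
      colourOf-injective (else _ s) at-p refl = contradiction (_ , s) md
      colourOf-injective (else _ s) at-q refl = contradiction (_ , s) me
      colourOf-injective (else _ s) (else _ t) refl = row-unique s t
      colour = colourOf ∘ position
      injective : ∀ {x y} → colour x ≡ colour y → x ≡ y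
      injective {x} {y} = colourOf-injective (position x) (position y)

  noDecomposition : ¬ HasK₃Decomposition (L ∨ᴳ K w)
  noDecomposition (T , isDec)
    with c , mc ← missingAt-A T isDec
    with d , c≢d , ocd , md ← mateA T isDec mc
    with e , c≢e , oce , me ← mateB T isDec (missing-transfer T isDec mc)
    with d ≟ e
  ... | no d≢e = noThreeMissing T isDec
    (missing-transfer T isDec mc) (missing-transfer T isDec md) me c≢d c≢e d≢e
  ... | yes refl = A≢B (base-injective (tri-unique (c≢d ∘ apex-injective)
          (tri-swapʳ (tri-swapˡ ocd)) (tri-swapʳ (tri-swapˡ oce))
          base≢apex base≢apex base≢apex base≢apex))
    where open Decomposition (L ∨ᴳ K w) T isDec

-- Arithmetic modulo N

module Residues (h : ℕ) where

  w N : ℕ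
  w = suc h * 2
  N = suc w

  residue : ℕ → Fin N
  residue m = m mod N

  -- A congruence is given by explicit multiples of N added on both sides; this avoids subtraction
  -- and leaves identities for the ring solver.
  residue-≡ : ∀ {m n} k l → m + k * N ≡ n + l * N → residue m ≡ residue n
  residue-≡ {m} {n} k l eq = toℕ-injective (begin
    toℕ (residue m)   ≡⟨ toℕ-fromℕ< (m%n<n m N) ⟩
    m % N             ≡⟨ [m+kn]%n≡m%n m k N ⟨
    (m + k * N) % N   ≡⟨ cong (_% N) eq ⟩
    (n + l * N) % N   ≡⟨ [m+kn]%n≡m%n n l N ⟩
    n % N             ≡⟨ toℕ-fromℕ< (m%n<n n N) ⟨
    toℕ (residue n)   ∎)
    where open ≡-Reasoning

  residue-toℕ : ∀ x → residue (toℕ x) ≡ x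
  residue-toℕ x = toℕ-injective (trans (toℕ-fromℕ< (m%n<n (toℕ x) N)) (m<n⇒m%n≡m (toℕ<n x)))

  toℕ-residue : ∀ m → ∃[ k ] m ≡ toℕ (residue m) + k * N
  toℕ-residue m = m / N , trans (m≡m%n+[m/n]*n m N)
    (cong (_+ m / N * N) (sym (toℕ-fromℕ< (m%n<n m N))))

  residue-elim : ∀ {m} x k l → m + k * N ≡ toℕ x + l * N → residue m ≡ x
  residue-elim x k l eq = trans (residue-≡ k l eq) (residue-toℕ x)

  o p q : Fin N
  o = zero
  p = suc zero
  q = fromℕ w

  infixl 6 _⊖_ _⊕_

  abstract

    -- The inverse of 2 modulo N is 2 + h, and − 1 is w.
    mean reflect : Fin N → Fin N → Fin N
    mean x y    = residue ((2 + h) * (toℕ x + toℕ y))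
    reflect z x = residue (2 * toℕ z + w * toℕ x)

    mean-comm : ∀ x y → mean x y ≡ mean y x
    mean-comm x y = cong (λ s → residue ((2 + h) * s)) (ℕ.+-comm (toℕ x) (toℕ y))

    mean-idem : ∀ x → mean x x ≡ x
    mean-idem x = residue-elim x 0 (toℕ x) (identity h (toℕ x))
      where
      identity : ∀ h x → (2 + h) * (x + x) + 0 * suc (suc h * 2) ≡ x + x * suc (suc h * 2)
      identity = solve-∀

    -- This is 2 · (x + y)/2 - x = y, resting on 2(2 + h) = N + 1. With `mean-reflect` it says that
    -- taking the mean with x and reflecting x are inverse maps; the laws about self-reflection,
    -- involution and distinctness follow from this formally.
    reflect-mean : ∀ x y → reflect (mean x y) x ≡ y
    reflect-mean x y with k , eq ← toℕ-residue ((2 + h) * (toℕ x + toℕ y)) =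
      residue-elim y (2 * k) (2 * toℕ x + toℕ y) (begin
        2 * m + w * toℕ x + 2 * k * N                       ≡⟨ regroup m k N (w * toℕ x) ⟩
        2 * (m + k * N) + w * toℕ x                         ≡⟨ cong (λ s → 2 * s + w * toℕ x) eq ⟨
        2 * ((2 + h) * (toℕ x + toℕ y)) + w * toℕ x         ≡⟨ identity h (toℕ x) (toℕ y) ⟩
        toℕ y + (2 * toℕ x + toℕ y) * N                     ∎)
      where
      open ≡-Reasoning
      m : ℕ
      m = toℕ (mean x y)
      regroup : ∀ m k n t → 2 * m + t + 2 * k * n ≡ 2 * (m + k * n) + t
      regroup = solve-∀
      identity : ∀ h x y → 2 * ((2 + h) * (x + y)) + suc h * 2 * x ≡ y + (2 * x + y) * suc (suc h * 2)
      identity = solve-∀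

    mean-reflect : ∀ z x → mean x (reflect z x) ≡ z
    mean-reflect z x with k , eq ← toℕ-residue (2 * toℕ z + w * toℕ x) =
      residue-elim z ((2 + h) * k) (toℕ z + (2 + h) * toℕ x) (begin
        (2 + h) * (toℕ x + r) + (2 + h) * k * N             ≡⟨ regroup h (toℕ x) r k N ⟩
        (2 + h) * (toℕ x + (r + k * N))                     ≡⟨ cong (λ s → (2 + h) * (toℕ x + s)) eq ⟨
        (2 + h) * (toℕ x + (2 * toℕ z + w * toℕ x))         ≡⟨ identity h (toℕ x) (toℕ z) ⟩
        toℕ z + (toℕ z + (2 + h) * toℕ x) * N               ∎)
      where
      open ≡-Reasoning
      r : ℕ
      r = toℕ (reflect z x)
      regroup : ∀ h x r k n → (2 + h) * (x + r) + (2 + h) * k * n ≡ (2 + h) * (x + (r + k * n))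
      regroup = solve-∀
      identity : ∀ h x z → (2 + h) * (x + (2 * z + suc h * 2 * x)) ≡ z + (z + (2 + h) * x) * suc (suc h * 2)
      identity = solve-∀

    reflect-self : ∀ x → reflect x x ≡ x
    reflect-self x = trans (cong (λ z → reflect z x) (sym (mean-idem x))) (reflect-mean x x)

    reflect-involutive : ∀ z x → reflect z (reflect z x) ≡ x
    reflect-involutive z x = begin
      reflect z (reflect z x)                             ≡⟨ cong (λ c → reflect c (reflect z x)) (mean-reflect z x) ⟨
      reflect (mean x (reflect z x)) (reflect z x)        ≡⟨ cong (λ c → reflect c (reflect z x)) (mean-comm x _) ⟩
      reflect (mean (reflect z x) x) (reflect z x)        ≡⟨ reflect-mean (reflect z x) x ⟩
      x                                                   ∎
      where open ≡-Reasoning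

    mean-≢ˡ : ∀ {x y} → x ≢ y → x ≢ mean x y
    mean-≢ˡ {x} {y} x≢y eq = x≢y (begin
      x                    ≡⟨ reflect-self x ⟨
      reflect x x          ≡⟨ cong (λ z → reflect z x) eq ⟩
      reflect (mean x y) x ≡⟨ reflect-mean x y ⟩
      y                    ∎)
      where open ≡-Reasoning

    reflect-≢ : ∀ {x z} → x ≢ z → x ≢ reflect z x
    reflect-≢ {x} {z} x≢z eq = x≢z (begin
      x                    ≡⟨ mean-idem x ⟨
      mean x x             ≡⟨ cong (mean x) eq ⟩
      mean x (reflect z x) ≡⟨ mean-reflect z x ⟩
      z                    ∎)
      where open ≡-Reasoning

    reflect-≢ᶜ : ∀ {x z} → x ≢ z → z ≢ reflect z x
    reflect-≢ᶜ {x} {z} x≢z eq = x≢z (begin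
      x                           ≡⟨ reflect-involutive z x ⟨
      reflect z (reflect z x)     ≡⟨ cong (reflect z) eq ⟨
      reflect z z                 ≡⟨ reflect-self z ⟩
      z                           ∎)
      where open ≡-Reasoning

    mean-pq : mean p q ≡ o
    mean-pq = residue-elim o 0 (2 + h) (trans (cong (λ s → (2 + h) * (1 + s) + 0) (toℕ-fromℕ w)) (identity h))
      where
      identity : ∀ h → (2 + h) * (1 + suc h * 2) + 0 ≡ (2 + h) * suc (suc h * 2)
      identity = solve-∀

    _⊖_ _⊕_ : Fin N → Fin N → Fin N
    y ⊖ x = residue (toℕ y + w * toℕ x)
    x ⊕ d = residue (toℕ x + toℕ d)

    ⊕-⊖ : ∀ x y → x ⊕ (y ⊖ x) ≡ y
    ⊕-⊖ x y with k , eq ← toℕ-residue (toℕ y + w * toℕ x) = residue-elim y k (toℕ x) (begin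
        toℕ x + toℕ (y ⊖ x) + k * N   ≡⟨ ℕ.+-assoc (toℕ x) _ _ ⟩
        toℕ x + (toℕ (y ⊖ x) + k * N) ≡⟨ cong (toℕ x +_) eq ⟨
        toℕ x + (toℕ y + w * toℕ x)   ≡⟨ identity w (toℕ x) (toℕ y) ⟩
        toℕ y + toℕ x * N             ∎)
      where
      open ≡-Reasoning
      identity : ∀ w x y → x + (y + w * x) ≡ y + x * suc w
      identity = solve-∀

    ⊖-⊕ : ∀ x d → (x ⊕ d) ⊖ d ≡ x
    ⊖-⊕ x d with k , eq ← toℕ-residue (toℕ x + toℕ d) = residue-elim x k (toℕ d) (begin
        toℕ (x ⊕ d) + w * toℕ d + k * N   ≡⟨ regroup (toℕ (x ⊕ d)) (w * toℕ d) (k * N) ⟩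
        toℕ (x ⊕ d) + k * N + w * toℕ d   ≡⟨ cong (_+ w * toℕ d) eq ⟨
        toℕ x + toℕ d + w * toℕ d         ≡⟨ identity w (toℕ x) (toℕ d) ⟩
        toℕ x + toℕ d * N                 ∎)
      where
      open ≡-Reasoning
      regroup : ∀ a b c → a + b + c ≡ a + c + b
      regroup = solve-∀
      identity : ∀ w x d → x + d + w * d ≡ x + d * suc w
      identity = solve-∀

    ⊖-injectiveʳ : ∀ {x y z} → y ⊖ x ≡ z ⊖ x → y ≡ z
    ⊖-injectiveʳ {x} {y} {z} eq = trans (sym (⊕-⊖ x y)) (trans (cong (x ⊕_) eq) (⊕-⊖ x z))

    ⊖-injectiveˡ : ∀ {x y z} → z ⊖ x ≡ z ⊖ y → x ≡ y
    ⊖-injectiveˡ {x} {y} {z} eq = begin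
      x                       ≡⟨ ⊖-⊕ x (z ⊖ x) ⟨
      x ⊕ (z ⊖ x) ⊖ (z ⊖ x)   ≡⟨ cong₂ _⊖_ (trans (⊕-⊖ x z) (sym (⊕-⊖ y z))) eq ⟩
      y ⊕ (z ⊖ y) ⊖ (z ⊖ y)   ≡⟨ ⊖-⊕ y (z ⊖ y) ⟩
      y                       ∎
      where open ≡-Reasoning

    ⊕-identityʳ : ∀ x → x ⊕ o ≡ x
    ⊕-identityʳ x = residue-elim x 0 0 (cong (_+ 0) (ℕ.+-identityʳ (toℕ x)))

    ⊕-q-p : ∀ x → x ⊕ q ⊕ p ≡ x
    ⊕-q-p x with k , eq ← toℕ-residue (toℕ x + toℕ q) = residue-elim x k 1 (begin
        toℕ (x ⊕ q) + 1 + k * N     ≡⟨ regroup (toℕ (x ⊕ q)) (k * N) ⟩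
        toℕ (x ⊕ q) + k * N + 1     ≡⟨ cong (_+ 1) eq ⟨
        toℕ x + toℕ q + 1           ≡⟨ cong (λ m → toℕ x + m + 1) (toℕ-fromℕ w) ⟩
        toℕ x + w + 1               ≡⟨ identity w (toℕ x) ⟩
        toℕ x + 1 * N               ∎)
      where
      open ≡-Reasoning
      regroup : ∀ a b → a + 1 + b ≡ a + b + 1
      regroup = solve-∀
      identity : ∀ w x → x + w + 1 ≡ x + 1 * suc w
      identity = solve-∀

    -- Translates differences of 1 and -1 into steps along the path 0 - 1 - ... - w, apart from the
    -- wrap-around from w to 0.
    ⊕-p : ∀ x → toℕ (x ⊕ p) ≡ suc (toℕ x) ⊎ (x ≡ q × x ⊕ p ≡ o)
    ⊕-p x with suc (toℕ x) ℕ.<? N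
    ... | yes <N = inj₁ (trans (toℕ-fromℕ< (m%n<n (toℕ x + 1) N))
                     (trans (cong (_% N) (ℕ.+-comm (toℕ x) 1)) (m<n⇒m%n≡m <N)))
    ... | no ≮N = inj₂ (x≡q , residue-elim o 0 1 (trans (cong (λ y → toℕ y + 1 + 0) x≡q)
                     (trans (cong (λ m → m + 1 + 0) (toℕ-fromℕ w)) (identity w))))
      where
      x≡q : x ≡ q
      x≡q = toℕ-injective (trans (ℕ.suc-injective (ℕ.≤-antisym (toℕ<n x) (ℕ.≮⇒≥ ≮N))) (sym (toℕ-fromℕ w)))
      identity : ∀ w → w + 1 + 0 ≡ 1 * suc w
      identity = solve-∀

  reflect-op : reflect o p ≡ q
  reflect-op = trans (cong (λ z → reflect z p) (sym mean-pq)) (reflect-mean p q)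

  reflect-oq : reflect o q ≡ p
  reflect-oq = trans (cong (reflect o) (sym reflect-op)) (reflect-involutive o p)

-- Seeds

module _ {A : Set} (_≟_ : DecidableEquality A) where

  thirdOf : A × A × A → A → A → Maybe A
  thirdOf (a , b , c) x y =
    if does (x ≟ a) then (if does (y ≟ b) then just c else if does (y ≟ c) then just b else nothing) else
    if does (x ≟ b) then (if does (y ≟ a) then just c else if does (y ≟ c) then just a else nothing) else
    if does (x ≟ c) then (if does (y ≟ a) then just b else if does (y ≟ b) then just a else nothing) else
    nothing

  thirdIn : List (A × A × A) → A → A → Maybe A
  thirdIn []       x y = nothing
  thirdIn (t ∷ ts) x y = thirdOf t x y <∣> thirdIn ts x y

Point : ℕ → Set → Set
Point s X = (X × Fin 6) ⊎ Fin s

pattern at x i = inj₁ (x , i)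
pattern hub r = inj₂ r

Local Code : ℕ → Set
Local s = Fin 6 ⊎ Fin s
Code s = Point s (Fin 3)

_≟ˡ_ : ∀ {s} → DecidableEquality (Local s)
_≟ˡ_ = Sum.≡-dec Fin._≟_ Fin._≟_

_≟ᶜ_ : ∀ {s} → DecidableEquality (Code s)
_≟ᶜ_ = Sum.≡-dec (Product.≡-dec Fin._≟_ Fin._≟_) Fin._≟_

∀⊎? : ∀ {A B : Set} {P : A ⊎ B → Set} → Dec (∀ a → P (inj₁ a)) → Dec (∀ b → P (inj₂ b)) → Dec (∀ x → P x)
∀⊎? l r = map′ (λ { (f , g) (inj₁ a) → f a ; (f , g) (inj₂ b) → g b })
               (λ h → (h ∘ inj₁) , (h ∘ inj₂)) (l ×-dec r)

∀ˡ? : ∀ {s} {P : Local s → Set} → (∀ l → Dec (P l)) → Dec (∀ l → P l)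
∀ˡ? P? = ∀⊎? (Fin.all? (P? ∘ inj₁)) (Fin.all? (P? ∘ inj₂))

∀ᶜ? : ∀ {s} {P : Code s → Set} → (∀ c → Dec (P c)) → Dec (∀ c → P c)
∀ᶜ? P? = ∀⊎? (map′ (λ f (a , i) → f a i) (λ f a i → f (a , i))
                   (Fin.all? λ a → Fin.all? λ i → P? (at a i)))
             (Fin.all? (P? ∘ inj₂))

-- Certain levels i, j, k carry the triples {(x , i) , (y , j) , (z , k)} in
-- which z is the mean of x and y: those with j = i, k = i + 1 (mod 6), and
-- (0 , 2 , 4) and (1 , 3 , 5).  The kind of (i , j) records the level of the
-- third point, and whether the mean is there, at i or at j.
Kind : Set
Kind = Maybe (Fin 3 × Fin 6)

pattern none        = nothing
pattern meanTo k    = just (0F , k)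
pattern midFirst k  = just (1F , k)
pattern midSecond k = just (2F , k)

kinds : Vec (Vec Kind 6) 6
kinds =
  (meanTo 1F   ∷ midSecond 0F ∷ meanTo 4F   ∷ none         ∷ midSecond 2F ∷ midFirst 5F  ∷ []) ∷
  (midFirst 0F ∷ meanTo 2F    ∷ midSecond 1F ∷ meanTo 5F   ∷ none         ∷ midSecond 3F ∷ []) ∷
  (meanTo 4F   ∷ midFirst 1F  ∷ meanTo 3F   ∷ midSecond 2F ∷ midSecond 0F ∷ none         ∷ []) ∷
  (none        ∷ meanTo 5F    ∷ midFirst 2F ∷ meanTo 4F    ∷ midSecond 3F ∷ midSecond 1F ∷ []) ∷
  (midFirst 2F ∷ none         ∷ midFirst 0F ∷ midFirst 3F  ∷ meanTo 5F    ∷ midSecond 4F ∷ []) ∷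
  (midSecond 5F ∷ midFirst 3F ∷ none        ∷ midFirst 1F  ∷ midFirst 4F  ∷ meanTo 0F    ∷ []) ∷ []

kind : Fin 6 → Fin 6 → Kind
kind i j = lookup (lookup kinds i) j

opp : Fin 6 → Fin 6
opp = lookup (3F ∷ 4F ∷ 5F ∷ 0F ∷ 1F ∷ 2F ∷ [])

_≟ᵏ_ : DecidableEquality Kind
_≟ᵏ_ = Maybe.≡-dec (Product.≡-dec Fin._≟_ Fin._≟_)

-- The level-wise form of the two laws of a partial Steiner operation: exchanging the first two
-- points, and exchanging the last two. Only opposite levels carry no transversal triple.
KindLaw : Fin 6 → Fin 6 → Kind → Set
KindLaw i j none          = j ≡ opp i
KindLaw i j (meanTo k)    = kind j i ≡ meanTo k × kind i k ≡ midSecond j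
KindLaw i j (midFirst k)  = kind j i ≡ midSecond k × kind i k ≡ midFirst j
KindLaw i j (midSecond k) = kind j i ≡ midFirst k × kind i k ≡ meanTo j

kindLaw? : ∀ i j e → Dec (KindLaw i j e)
kindLaw? i j none          = j Fin.≟ opp i
kindLaw? i j (meanTo k)    = (kind j i ≟ᵏ meanTo k) ×-dec (kind i k ≟ᵏ midSecond j)
kindLaw? i j (midFirst k)  = (kind j i ≟ᵏ midSecond k) ×-dec (kind i k ≟ᵏ midFirst j)
kindLaw? i j (midSecond k) = (kind j i ≟ᵏ midFirst k) ×-dec (kind i k ≟ᵏ meanTo j)

abstract
  kindLaw : ∀ i j → KindLaw i j (kind i j)
  kindLaw = toWitness {a? = Fin.all? λ i → Fin.all? λ j → kindLaw? i j (kind i j)} _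

abstract
  opp-involutive : ∀ i → opp (opp i) ≡ i
  opp-involutive = toWitness {a? = Fin.all? λ i → opp (opp i) Fin.≟ i} _

abstract
  opp-≢ : ∀ i → opp i ≢ i
  opp-≢ = toWitness {a? = Fin.all? λ i → ¬? (opp i Fin.≟ i)} _

abstract
  kind-opp : ∀ i → kind i (opp i) ≡ none
  kind-opp = toWitness {a? = Fin.all? λ i → kind i (opp i) ≟ᵏ none} _

-- What a seed prescribes for a pair of points with positions in the window
-- {o , p , q}: keep the base system, make it an edge of the leave, or put it
-- into a triple with a given third point.
Entry : ℕ → Set
Entry s = Maybe (Maybe (Code s))

pattern keep    = nothing
pattern free    = just nothing
pattern block c = just (just c)

record SeedData : Set where
  field
    hubs    : ℕ
    lines   : List (Local hubs × Local hubs × Local hubs)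
    blocks  : List (Code hubs × Code hubs × Code hubs)
    twisted : Fin 6 → Bool
    hubEdge : Fin hubs → Fin hubs → Bool
    hubColour : Fin hubs → Fin hubs → Fin 4

  line : Local hubs → Local hubs → Maybe (Local hubs)
  line = thirdIn _≟ˡ_ lines

  -- The loops of the twisted graph: the pairs at position 1 and at position -1 between opposite
  -- twisted levels.
  isFree : Code hubs → Code hubs → Bool
  isFree (at a i) (at b j) = does (j Fin.≟ opp i) ∧ does (a Fin.≟ b) ∧ not (does (a Fin.≟ 0F)) ∧ twisted i
  isFree _        _        = false

  entry : Code hubs → Code hubs → Entry hubs
  entry c d = if isFree c d then free else Maybe.map just (thirdIn _≟ᶜ_ blocks c d)

  atPosition : Fin 3 → Local hubs → Code hubs
  atPosition a (inj₁ i) = at a i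
  atPosition a (inj₂ r) = hub r

  -- `1F` and `2F` stand for 1 and -1. Recorded are the values that hold for every N: the mean of 1
  -- and -1 is 0, and reflection in 0 exchanges them.
  windowMean windowReflect : Fin 3 → Fin 3 → Maybe (Fin 3)
  windowMean 1F 2F = just 0F
  windowMean 2F 1F = just 0F
  windowMean _  _  = nothing
  windowReflect 0F 1F = just 2F
  windowReflect 0F 2F = just 1F
  windowReflect _  _  = nothing

  -- The base operation on the window; keep where its value may leave the window.
  knownCross : Kind → Fin 3 → Fin 3 → Entry hubs
  knownCross none          a b = free
  knownCross (meanTo k)    a b = Maybe.map (λ m → just (at m k)) (windowMean a b)
  knownCross (midFirst k)  a b = Maybe.map (λ m → just (at m k)) (windowReflect a b)
  knownCross (midSecond k) a b = Maybe.map (λ m → just (at m k)) (windowReflect b a)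

  known : Code hubs → Code hubs → Entry hubs
  known (at a i) (at b j) with a Fin.≟ b
  ... | yes _ = just (Maybe.map (atPosition a) (line (inj₁ i) (inj₁ j)))
  ... | no  _ = knownCross (kind i j) a b
  known (at a i) (hub r)  = just (Maybe.map (atPosition a) (line (inj₁ i) (inj₂ r)))
  known (hub r)  (at a i) = just (Maybe.map (atPosition a) (line (inj₂ r) (inj₁ i)))
  known (hub r)  (hub t)  = free

  Hubs : Local hubs → Local hubs → Set
  Hubs (inj₂ _) (inj₂ _) = ⊤
  Hubs _        _        = ⊥

  hubs? : ∀ l m → Dec (Hubs l m)
  hubs? (inj₂ _) (inj₂ _) = yes tt
  hubs? (inj₁ _) _        = no λ ()
  hubs? (inj₂ _) (inj₁ _) = no λ ()

  -- The lines cover every pair of distinct local points except the pairs of hubs, which belong to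
  -- all positions at once.
  LineLaw : Local hubs → Local hubs → Maybe (Local hubs) → Set
  LineLaw l m nothing  = l ≡ m ⊎ Hubs l m
  LineLaw l m (just n) = line m l ≡ just n × line l n ≡ just m × l ≢ m × ¬ Hubs l m

  lineLaw? : ∀ l m n → Dec (LineLaw l m n)
  lineLaw? l m nothing  = (l ≟ˡ m) ⊎-dec hubs? l m
  lineLaw? l m (just n) = (line m l ≟ᵐ just n) ×-dec (line l n ≟ᵐ just m) ×-dec ¬? (l ≟ˡ m) ×-dec ¬? (hubs? l m)
    where _≟ᵐ_ = Maybe.≡-dec _≟ˡ_

  _≟ᵉ_ : DecidableEquality (Entry hubs)
  _≟ᵉ_ = Maybe.≡-dec (Maybe.≡-dec _≟ᶜ_)

  -- A base triple given up at one pair must be given up at its other pairs too. A pair whose base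
  -- value is not known to lie in the window may not be changed, since its third point could not be
  -- controlled.
  Closed : Code hubs → Entry hubs → Set
  Closed c keep      = ⊥
  Closed c free      = ⊤
  Closed c (block e) = entry c e ≢ keep

  closed? : ∀ c e → Dec (Closed c e)
  closed? c keep      = no λ ()
  closed? c free      = yes tt
  closed? c (block e) = ¬? (entry c e ≟ᵉ keep)

  EntryLaw : Code hubs → Code hubs → Entry hubs → Set
  EntryLaw c d keep      = ⊤
  EntryLaw c d free      = entry d c ≡ free × Closed c (known c d)
  EntryLaw c d (block e) = entry d c ≡ block e × entry c e ≡ block d × c ≢ d × Closed c (known c d)

  entryLaw? : ∀ c d e → Dec (EntryLaw c d e)
  entryLaw? c d keep      = yes tt
  entryLaw? c d free      = (entry d c ≟ᵉ free) ×-dec closed? c (known c d)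
  entryLaw? c d (block e) =
    (entry d c ≟ᵉ block e) ×-dec (entry c e ≟ᵉ block d) ×-dec ¬? (c ≟ᶜ d) ×-dec closed? c (known c d)

  data Status : Set where
    kept freed blocked notFreed : Status

  Has : Status → Entry hubs → Set
  Has kept     e         = e ≡ keep
  Has freed    e         = e ≡ free
  Has blocked  (block _) = ⊤
  Has blocked  _         = ⊥
  Has notFreed e         = e ≢ free

  has? : ∀ s e → Dec (Has s e)
  has? kept     e         = e ≟ᵉ keep
  has? freed    e         = e ≟ᵉ free
  has? blocked  (block _) = yes tt
  has? blocked  free      = no λ ()
  has? blocked  keep      = no λ ()
  has? notFreed e         = ¬? (e ≟ᵉ free)

  -- What turns a complete bipartite graph minus a matching into the twisted graph: the pairs
  -- joining 0 with 1 or -1 are put into triples, the loops at 1 and -1 are freed, and every other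
  -- edge of the window stays.
  oppStatus : Bool → Fin 3 → Fin 3 → Status
  oppStatus false a  b  = if does (a Fin.≟ b) then notFreed else kept
  oppStatus true  0F 0F = notFreed
  oppStatus true  0F (suc _) = blocked
  oppStatus true  (suc _) 0F = blocked
  oppStatus true  (suc a) (suc b) = if does (a Fin.≟ b) then freed else kept

  hubStatus : Bool → Status
  hubStatus true  = kept
  hubStatus false = blocked

  status : Code hubs → Code hubs → Status
  status (at a i) (at b j) = if does (j Fin.≟ opp i) then oppStatus (twisted i) a b else notFreed
  status (at _ _) (hub _)  = notFreed
  status (hub _)  (at _ _) = notFreed
  status (hub r)  (hub t)  = if does (r Fin.≟ t) then kept else hubStatus (hubEdge r t)

  hubNeighbours : Fin hubs → List (Fin hubs)
  hubNeighbours r = filter (λ t → hubEdge r t ≟ᵇ true) (allFin hubs)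

  HubEdge : Fin hubs × Fin hubs → Set
  HubEdge (r , t) = r Fin.< t × hubEdge r t ≡ true

  HubEdge? : Decidable HubEdge
  HubEdge? (r , t) = (r <? t) ×-dec (hubEdge r t ≟ᵇ true)

  hubEdges : List (Fin hubs × Fin hubs)
  hubEdges = filter HubEdge? (cartesianProduct (allFin hubs) (allFin hubs))

  record Lawful : Set where
    field
      lineLaw          : ∀ l m → LineLaw l m (line l m)
      entryLaw         : ∀ c d → EntryLaw c d (entry c d)
      statusLaw        : ∀ c d → Has (status c d) (entry c d)
      twisted-opp      : ∀ i → twisted (opp i) ≡ twisted i
      twisted-0        : twisted 0F ≡ true
      hubEdge-irrefl   : ∀ r → hubEdge r r ≡ false
      hubColour-sym    : ∀ r t → hubColour r t ≡ hubColour t r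
      hubColour-proper : ∀ r t v → hubEdge r t ≡ true → hubEdge r v ≡ true →
                         hubColour r t ≡ hubColour r v → t ≡ v
      hubNeighbours-even : ∀ r → length (hubNeighbours r) % 2 ≡ 0

  lawful? : Dec Lawful
  lawful? = map′
    (λ (a , b , c , d , e , f , g , h , i) → record
      { lineLaw = a ; entryLaw = b ; statusLaw = c ; twisted-opp = d ; twisted-0 = e
      ; hubEdge-irrefl = f ; hubColour-sym = g ; hubColour-proper = h ; hubNeighbours-even = i })
    (λ law → let open Lawful law in
      lineLaw , entryLaw , statusLaw , twisted-opp , twisted-0 , hubEdge-irrefl ,
      hubColour-sym , hubColour-proper , hubNeighbours-even)
    ((∀ˡ? λ l → ∀ˡ? λ m → lineLaw? l m (line l m)) ×-dec
     (∀ᶜ? λ c → ∀ᶜ? λ d → entryLaw? c d (entry c d)) ×-dec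
     (∀ᶜ? λ c → ∀ᶜ? λ d → has? (status c d) (entry c d)) ×-dec
     (Fin.all? λ i → twisted (opp i) ≟ᵇ twisted i) ×-dec
     (twisted 0F ≟ᵇ true) ×-dec
     (Fin.all? λ r → hubEdge r r ≟ᵇ false) ×-dec
     (Fin.all? λ r → Fin.all? λ t → hubColour r t Fin.≟ hubColour t r) ×-dec
     (Fin.all? λ r → Fin.all? λ t → Fin.all? λ v →
       (hubEdge r t ≟ᵇ true) →-dec (hubEdge r v ≟ᵇ true) →-dec
       (hubColour r t Fin.≟ hubColour r v) →-dec (t Fin.≟ v)) ×-dec
     (Fin.all? λ r → length (hubNeighbours r) % 2 ℕ.≟ 0))

-- The lines of seed₁ form a Fano plane, those of seed₅ a one-factorisation of
-- the complete graph on the six levels.  The blocks were found by computer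
-- search.  The leave of seed₅ on the hubs is a pair of triangles sharing hub 4.
seed₁ : SeedData
seed₁ = record
  { hubs    = 1
  ; lines   =
      (inj₁ 0F , inj₁ 3F , inj₂ 0F) ∷ (inj₁ 1F , inj₁ 4F , inj₂ 0F) ∷ (inj₁ 2F , inj₁ 5F , inj₂ 0F) ∷
      (inj₁ 0F , inj₁ 2F , inj₁ 4F) ∷ (inj₁ 0F , inj₁ 1F , inj₁ 5F) ∷
      (inj₁ 1F , inj₁ 2F , inj₁ 3F) ∷ (inj₁ 3F , inj₁ 4F , inj₁ 5F) ∷ []
  ; blocks  =
      (at 0F 0F , at 1F 3F , at 1F 5F) ∷ (at 0F 0F , at 2F 3F , at 2F 5F) ∷
      (at 1F 0F , at 2F 0F , hub 0F)   ∷
      (at 1F 0F , at 0F 1F , at 1F 4F) ∷ (at 2F 0F , at 0F 1F , at 2F 4F) ∷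
      (at 1F 0F , at 1F 2F , at 0F 3F) ∷ (at 2F 0F , at 2F 2F , at 0F 3F) ∷
      (at 1F 1F , at 1F 2F , hub 0F)   ∷ (at 2F 1F , at 2F 2F , hub 0F)   ∷
      (at 1F 1F , at 1F 3F , at 0F 4F) ∷ (at 2F 1F , at 2F 3F , at 0F 4F) ∷
      (at 0F 2F , at 1F 5F , at 2F 5F) ∷ (at 1F 2F , at 2F 2F , at 0F 5F) ∷
      (at 1F 2F , at 1F 3F , at 1F 4F) ∷ (at 2F 2F , at 2F 3F , at 2F 4F) ∷
      (at 1F 3F , at 2F 3F , hub 0F)   ∷
      (at 1F 4F , at 1F 5F , hub 0F)   ∷ (at 2F 4F , at 2F 5F , hub 0F)   ∷ []
  ; twisted = λ _ → true
  ; hubEdge = λ _ _ → false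
  ; hubColour = λ _ _ → 0F
  }

seed₅ : SeedData
seed₅ = record
  { hubs    = 5
  ; lines   =
      (inj₁ 0F , inj₁ 3F , inj₂ 0F) ∷ (inj₁ 1F , inj₁ 2F , inj₂ 0F) ∷ (inj₁ 4F , inj₁ 5F , inj₂ 0F) ∷
      (inj₁ 0F , inj₁ 1F , inj₂ 1F) ∷ (inj₁ 2F , inj₁ 5F , inj₂ 1F) ∷ (inj₁ 3F , inj₁ 4F , inj₂ 1F) ∷
      (inj₁ 0F , inj₁ 2F , inj₂ 2F) ∷ (inj₁ 1F , inj₁ 4F , inj₂ 2F) ∷ (inj₁ 3F , inj₁ 5F , inj₂ 2F) ∷
      (inj₁ 0F , inj₁ 4F , inj₂ 3F) ∷ (inj₁ 1F , inj₁ 5F , inj₂ 3F) ∷ (inj₁ 2F , inj₁ 3F , inj₂ 3F) ∷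
      (inj₁ 0F , inj₁ 5F , inj₂ 4F) ∷ (inj₁ 1F , inj₁ 3F , inj₂ 4F) ∷ (inj₁ 2F , inj₁ 4F , inj₂ 4F) ∷ []
  ; blocks  =
      (at 0F 0F , at 0F 2F , at 0F 3F) ∷ (at 0F 0F , at 1F 3F , hub 2F) ∷ (at 0F 0F , at 2F 3F , hub 0F) ∷
      (at 1F 0F , at 1F 1F , at 1F 4F) ∷ (at 1F 0F , at 0F 3F , hub 3F) ∷ (at 1F 0F , hub 0F , hub 1F) ∷
      (at 2F 0F , at 0F 3F , hub 0F) ∷ (at 1F 1F , hub 1F , hub 2F) ∷ (at 0F 2F , hub 2F , hub 3F) ∷
      (at 1F 3F , at 1F 5F , hub 0F) ∷ (at 1F 4F , at 1F 5F , hub 2F) ∷ (at 1F 4F , hub 0F , hub 3F) ∷ []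
  ; twisted = λ { 0F → true ; 3F → true ; _ → false }
  ; hubEdge = lookup₂
      ((false ∷ false ∷ true  ∷ false ∷ true  ∷ []) ∷
       (false ∷ false ∷ false ∷ true  ∷ true  ∷ []) ∷
       (true  ∷ false ∷ false ∷ false ∷ true  ∷ []) ∷
       (false ∷ true  ∷ false ∷ false ∷ true  ∷ []) ∷
       (true  ∷ true  ∷ true  ∷ true  ∷ false ∷ []) ∷ [])
  ; hubColour = lookup₂
      ((0F ∷ 0F ∷ 1F ∷ 0F ∷ 0F ∷ []) ∷
       (0F ∷ 0F ∷ 0F ∷ 0F ∷ 1F ∷ []) ∷
       (1F ∷ 0F ∷ 0F ∷ 0F ∷ 2F ∷ []) ∷
       (0F ∷ 0F ∷ 0F ∷ 0F ∷ 3F ∷ []) ∷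
       (0F ∷ 1F ∷ 2F ∷ 3F ∷ 0F ∷ []) ∷ [])
  }
  where
  lookup₂ : ∀ {A : Set} {m n} → Vec (Vec A n) m → Fin m → Fin n → A
  lookup₂ rows r t = lookup (lookup rows r) t

abstract
  -- Decided by evaluation: seeds do not mention N, so this finite check is valid for all w.
  lawful₁ : SeedData.Lawful seed₁
  lawful₁ = toWitness {a? = SeedData.lawful? seed₁} _

abstract
  lawful₅ : SeedData.Lawful seed₅
  lawful₅ = toWitness {a? = SeedData.lawful? seed₅} _

-- The system and its leave

module Edges (h : ℕ) where
  open Residues h

  data Touch : Fin N → Fin N → Set where
    o-p : Touch o p
    o-q : Touch o q
    p-o : Touch p o
    q-o : Touch q o

  -- In the twisted graph, o has degree w − 2 and every other position degree w.
  data Edge : Bool → Fin N → Fin N → Set where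
    plain  : ∀ {x y} → x ≢ y → Edge false x y
    far    : ∀ {x y} → x ≢ y → ¬ Touch x y → Edge true x y
    loop-p : Edge true p p
    loop-q : Edge true q q

  touch-sym : ∀ {x y} → Touch x y → Touch y x
  touch-sym o-p = p-o
  touch-sym o-q = q-o
  touch-sym p-o = o-p
  touch-sym q-o = o-q

  edge-sym : ∀ {t x y} → Edge t x y → Edge t y x
  edge-sym (plain x≢y)  = plain (x≢y ∘ sym)
  edge-sym (far x≢y ¬t) = far (x≢y ∘ sym) (¬t ∘ touch-sym)
  edge-sym loop-p       = loop-p
  edge-sym loop-q       = loop-q

module Construction (h : ℕ) (seed : SeedData) (lawful : SeedData.Lawful seed) where
  open Residues h public
  open Edges h public
  open SeedData seed public
  open Lawful lawful public

  P : Set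
  P = Point hubs (Fin N)

  pos : Fin 3 → Fin N
  pos 0F = o
  pos 1F = p
  pos 2F = q

  o≢q : o ≢ q
  o≢q ()

  p≢q : p ≢ q
  p≢q ()

  pos-injective : ∀ {a b} → pos a ≡ pos b → a ≡ b
  pos-injective {0F} {0F} _ = refl
  pos-injective {1F} {1F} _ = refl
  pos-injective {2F} {2F} _ = refl
  pos-injective {0F} {1F} ()
  pos-injective {0F} {2F} eq = contradiction eq o≢q
  pos-injective {1F} {0F} ()
  pos-injective {1F} {2F} eq = contradiction eq p≢q
  pos-injective {2F} {0F} eq = contradiction (sym eq) o≢q
  pos-injective {2F} {1F} eq = contradiction (sym eq) p≢q

  decode : Code hubs → P
  decode (at a i) = at (pos a) i
  decode (hub r)  = hub r

  decode-injective : ∀ {c d} → decode c ≡ decode d → c ≡ d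
  decode-injective {at a i} {at b j} eq =
    let ab , ij = Product.,-injective (Sum.inj₁-injective eq) in cong₂ at (pos-injective ab) ij
  decode-injective {hub r}  {hub .r} refl = refl

  code? : ∀ x → Dec (∃[ c ] decode c ≡ x)
  code? (hub r) = yes (hub r , refl)
  code? (at x i) with Fin.any? (λ a → pos a Fin.≟ x)
  ... | yes (a , refl) = yes (at a i , refl)
  ... | no absent = no λ { (at a _ , refl) → absent (a , refl) }

  place : Fin N → Local hubs → P
  place x (inj₁ i) = at x i
  place x (inj₂ r) = hub r

  cross : Kind → Fin N → Fin N → Maybe P
  cross none          x y = nothing
  cross (meanTo k)    x y = just (at (mean x y) k)
  cross (midFirst k)  x y = just (at (reflect x y) k)
  cross (midSecond k) x y = just (at (reflect y x) k)

  base : P → P → Maybe P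
  base (at x i) (at y j) with x Fin.≟ y
  ... | yes _ = Maybe.map (place x) (line (inj₁ i) (inj₁ j))
  ... | no _  = cross (kind i j) x y
  base (at x i) (hub r)  = Maybe.map (place x) (line (inj₁ i) (inj₂ r))
  base (hub r)  (at x i) = Maybe.map (place x) (line (inj₂ r) (inj₁ i))
  base (hub _)  (hub _)  = nothing

  line-hubs : ∀ r t → line (inj₂ r) (inj₂ t) ≡ nothing
  line-hubs r t with line (inj₂ r) (inj₂ t) | lineLaw (inj₂ r) (inj₂ t)
  ... | nothing | _ = refl
  ... | just _  | _ , _ , _ , ¬hubs = contradiction _ ¬hubs

  base-local : ∀ x l m → base (place x l) (place x m) ≡ Maybe.map (place x) (line l m)
  base-local x (inj₁ i) (inj₁ j) with x Fin.≟ x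
  ... | yes _ = refl
  ... | no x≢x = contradiction refl x≢x
  base-local x (inj₁ i) (inj₂ r) = refl
  base-local x (inj₂ r) (inj₁ i) = refl
  base-local x (inj₂ r) (inj₂ t) = sym (cong (Maybe.map (place x)) (line-hubs r t))

  base-cross : ∀ {x y} i j → x ≢ y → base (at x i) (at y j) ≡ cross (kind i j) x y
  base-cross {x} {y} i j x≢y with x Fin.≟ y
  ... | yes x≡y = contradiction x≡y x≢y
  ... | no _ = refl

  data PairView : P → P → Set where
    local  : ∀ x l m → PairView (place x l) (place x m)
    across : ∀ {x y} i j → x ≢ y → PairView (at x i) (at y j)

  pairView : ∀ a b → PairView a b
  pairView (at x i) (at y j) with x Fin.≟ y
  ... | yes refl = local x (inj₁ i) (inj₁ j)
  ... | no x≢y = across i j x≢y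
  pairView (at x i) (hub r)  = local x (inj₁ i) (inj₂ r)
  pairView (hub r)  (at x i) = local x (inj₂ r) (inj₁ i)
  -- Two hubs lie at every position; o is an arbitrary choice.
  pairView (hub r)  (hub t)  = local o (inj₂ r) (inj₂ t)

  base-comm : ∀ {a b c} → base a b ≡ just c → base b a ≡ just c
  base-comm {a} {b} eq with pairView a b
  ... | local x l m with line l m | lineLaw l m | trans (sym (base-local x l m)) eq
  ...   | just n | ml , _ | refl = trans (base-local x m l) (cong (Maybe.map (place x)) ml)
  base-comm eq | across {x} {y} i j x≢y with kind i j | kindLaw i j | trans (sym (base-cross i j x≢y)) eq
  ... | meanTo k | ji , _ | refl rewrite base-cross j i (x≢y ∘ sym) | ji =
    cong (λ z → just (at z k)) (mean-comm y x)
  ... | midFirst k | ji , _ | refl rewrite base-cross j i (x≢y ∘ sym) | ji = refl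
  ... | midSecond k | ji , _ | refl rewrite base-cross j i (x≢y ∘ sym) | ji = refl

  base-swap : ∀ {a b c} → base a b ≡ just c → base a c ≡ just b
  base-swap {a} {b} eq with pairView a b
  ... | local x l m with line l m | lineLaw l m | trans (sym (base-local x l m)) eq
  ...   | just n | _ , ln , _ | refl = trans (base-local x l n) (cong (Maybe.map (place x)) ln)
  base-swap eq | across {x} {y} i j x≢y with kind i j | kindLaw i j | trans (sym (base-cross i j x≢y)) eq
  ... | meanTo k | _ , ik | refl rewrite base-cross i k (mean-≢ˡ x≢y) | ik =
    cong (λ z → just (at z j)) (reflect-mean x y)
  ... | midFirst k | _ , ik | refl rewrite base-cross i k (reflect-≢ᶜ (x≢y ∘ sym)) | ik =
    cong (λ z → just (at z j)) (reflect-involutive x y)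
  ... | midSecond k | _ , ik | refl rewrite base-cross i k (reflect-≢ x≢y) | ik =
    cong (λ z → just (at z j)) (mean-reflect y x)

  base-diag : ∀ a → base a a ≡ nothing
  base-diag (hub r) = refl
  base-diag (at x i) = trans (base-local x (inj₁ i) (inj₁ i)) (cong (Maybe.map (place x)) none-diag)
    where
    none-diag : line (inj₁ i) (inj₁ i) ≡ nothing
    none-diag with line (inj₁ i) (inj₁ i) | lineLaw (inj₁ i) (inj₁ i)
    ... | nothing | _ = refl
    ... | just _  | _ , _ , i≢i , _ = contradiction refl i≢i

  decode-atPosition : ∀ a l → decode (atPosition a l) ≡ place (pos a) l
  decode-atPosition a (inj₁ i) = refl
  decode-atPosition a (inj₂ r) = refl

  windowMean-sound : ∀ {a b m} → windowMean a b ≡ just m → mean (pos a) (pos b) ≡ pos m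
  windowMean-sound {1F} {2F} refl = mean-pq
  windowMean-sound {2F} {1F} refl = trans (mean-comm q p) mean-pq

  windowReflect-sound : ∀ {a b m} → windowReflect a b ≡ just m → reflect (pos a) (pos b) ≡ pos m
  windowReflect-sound {0F} {1F} refl = reflect-op
  windowReflect-sound {0F} {2F} refl = reflect-oq

  known-local : ∀ a l m → base (place (pos a) l) (place (pos a) m) ≡
                Maybe.map decode (Maybe.map (atPosition a) (line l m))
  known-local a l m rewrite base-local (pos a) l m with line l m
  ... | nothing = refl
  ... | just n = cong just (sym (decode-atPosition a n))

  known-sound : ∀ c d {e} → known c d ≡ just e → base (decode c) (decode d) ≡ Maybe.map decode e
  known-sound (at a i) (at b j) eq with a Fin.≟ b
  known-sound (at a i) (at b j) refl | yes refl = known-local a (inj₁ i) (inj₁ j)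
  known-sound (at a i) (at b j) eq | no a≢b
    rewrite base-cross i j (a≢b ∘ pos-injective) with kind i j
  known-sound (at a i) (at b j) refl | no _ | none = refl
  known-sound (at a i) (at b j) eq | no _ | meanTo k with windowMean a b in eq′
  known-sound (at a i) (at b j) refl | no _ | meanTo k | just m =
    cong (λ z → just (at z k)) (windowMean-sound eq′)
  known-sound (at a i) (at b j) eq | no _ | midFirst k with windowReflect a b in eq′
  known-sound (at a i) (at b j) refl | no _ | midFirst k | just m =
    cong (λ z → just (at z k)) (windowReflect-sound eq′)
  known-sound (at a i) (at b j) eq | no _ | midSecond k with windowReflect b a in eq′
  known-sound (at a i) (at b j) refl | no _ | midSecond k | just m =
    cong (λ z → just (at z k)) (windowReflect-sound eq′)
  known-sound (at a i) (hub r)  refl = known-local a (inj₁ i) (inj₂ r)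
  known-sound (hub r)  (at a i) refl = known-local a (inj₂ r) (inj₁ i)
  known-sound (hub r)  (hub t)  refl = refl

  override : Entry hubs → Maybe P → Maybe P
  override keep      m = m
  override free      m = nothing
  override (block c) m = just (decode c)

  op : P → P → Maybe P
  op a b with code? a | code? b
  ... | yes (c , _) | yes (d , _) = override (entry c d) (base a b)
  ... | yes _       | no _        = base a b
  ... | no _        | _           = base a b

  op-decode : ∀ c d → op (decode c) (decode d) ≡ override (entry c d) (base (decode c) (decode d))
  op-decode c d with code? (decode c) | code? (decode d)
  ... | yes (c′ , eq) | yes (d′ , eq′) rewrite decode-injective {c′} eq | decode-injective {d′} eq′ = refl
  ... | yes _         | no absent        = contradiction (d , refl) absent
  ... | no absent       | _              = contradiction (c , refl) absent

  -- Stated through all codes of the two points, so that it holds vacuously once a point lies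
  -- outside the window.
  Kept : P → P → Set
  Kept a b = ∀ {c d} → decode c ≡ a → decode d ≡ b → entry c d ≡ keep

  data OpView : P → P → Set where
    changed : ∀ c d → entry c d ≢ keep → OpView (decode c) (decode d)
    kept    : ∀ {a b} → Kept a b → OpView a b

  opView : ∀ a b → OpView a b
  opView a b with code? a | code? b
  ... | no absent | _ = kept λ ca _ → contradiction (_ , ca) absent
  ... | yes _ | no absent = kept λ _ db → contradiction (_ , db) absent
  ... | yes (c , refl) | yes (d , refl) with entry c d ≟ᵉ keep
  ...   | no ≢keep = changed c d ≢keep
  ...   | yes ≡keep = kept λ {c′} {d′} eq eq′ →
            trans (cong₂ entry (decode-injective {c′} eq) (decode-injective {d′} eq′)) ≡keep

  op-kept : ∀ {a b} → Kept a b → op a b ≡ base a b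
  op-kept {a} {b} k with code? a | code? b
  ... | yes (c , ca) | yes (d , db) rewrite k {c} {d} ca db = refl
  ... | yes _        | no _         = refl
  ... | no _         | _            = refl

  kept-sym : ∀ {a b} → Kept a b → Kept b a
  kept-sym k {c} {d} cb da with entry c d | entryLaw c d
  ... | keep    | _ = refl
  ... | free    | dc , _ = contradiction (trans (sym (k {d} {c} da cb)) dc) λ ()
  ... | block _ | dc , _ = contradiction (trans (sym (k {d} {c} da cb)) dc) λ ()

  notClosed : ∀ c d {b} → Kept (decode c) b → base (decode c) (decode d) ≡ just b → ¬ Closed c (known c d)
  notClosed c d k eq with known c d in known≡
  ... | free    = λ _ → contradiction (trans (sym eq) (known-sound c d known≡)) λ ()
  ... | block e = λ ≢keep → ≢keep (k {c} {e} refl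
    (sym (just-injective (trans (sym eq) (known-sound c d known≡)))))

  -- If the pair a, c had been changed, closure would make b a window point and the pair a, b
  -- changed as well. Hence a base triple survives as a whole or not at all.
  kept-third : ∀ {a b c} → Kept a b → base a b ≡ just c → Kept a c
  kept-third {a} {b} k eq {d} {e} refl refl with entry d e in de | entryLaw d e
  ... | keep | _ = refl
  ... | free    | _ , closed         = contradiction closed (notClosed d e k (base-swap {decode d} {b} eq))
  ... | block _ | _ , _ , _ , closed = contradiction closed (notClosed d e k (base-swap {decode d} {b} eq))

  op-isPartialSteiner : PartialSteiner op
  op-isPartialSteiner = record
    { op-comm = λ {a} {b} → comm {a} {b} ; op-swap = λ {a} {b} → swap {a} {b} ; op-diag = diag }
    where
    comm : ∀ {a b c} → op a b ≡ just c → op b a ≡ just c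
    comm {a} {b} eq with opView a b
    ... | kept k = trans (op-kept (kept-sym k)) (base-comm {a} {b} (trans (sym (op-kept k)) eq))
    ... | changed c d ≢keep with entry c d | entryLaw c d | trans (sym (op-decode c d)) eq
    ...   | keep    | _      | _    = contradiction refl ≢keep
    ...   | block e | dc , _ | refl =
      trans (op-decode d c) (cong (λ e → override e (base (decode d) (decode c))) dc)
    swap : ∀ {a b c} → op a b ≡ just c → op a c ≡ just b
    swap {a} {b} eq with opView a b
    ... | kept k = trans (op-kept (kept-third k base≡)) (base-swap {a} {b} base≡)
      where base≡ = trans (sym (op-kept k)) eq
    ... | changed c d ≢keep with entry c d | entryLaw c d | trans (sym (op-decode c d)) eq
    ...   | keep    | _          | _    = contradiction refl ≢keep
    ...   | block e | _ , ce , _ | refl =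
      trans (op-decode c e) (cong (λ f → override f (base (decode c) (decode e))) ce)
    diag : ∀ a → op a a ≡ nothing
    diag a with code? a
    ... | no _ = base-diag a
    ... | yes (c , _) with entry c c | entryLaw c c
    ...   | keep    | _ = base-diag a
    ...   | free    | _ = refl
    ...   | block _ | _ , _ , c≢c , _ = contradiction refl c≢c

  -- The leave in closed form. As i runs through all six levels, `opposite` yields each edge in both
  -- directions.
  data LeaveAdj : P → P → Set where
    opposite : ∀ {x y} i → Edge (twisted i) x y → LeaveAdj (at x i) (at y (opp i))
    between  : ∀ {r t} → hubEdge r t ≡ true → LeaveAdj (hub r) (hub t)

  LeaveAdj-≢ : ∀ {a b} → LeaveAdj a b → a ≢ b
  LeaveAdj-≢ (opposite i _) eq = opp-≢ i (sym (proj₂ (Product.,-injective (Sum.inj₁-injective eq))))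
  LeaveAdj-≢ (between {r} e) refl =
    contradiction (trans (sym e) (hubEdge-irrefl r)) λ ()

  statusAt : ∀ a i b j → Has (if does (j Fin.≟ opp i) then oppStatus (twisted i) a b else notFreed)
             (entry (at a i) (at b j))
  statusAt a i b j = statusLaw (at a i) (at b j)

  statusOpp : ∀ a i b → Has (oppStatus (twisted i) a b) (entry (at a i) (at b (opp i)))
  statusOpp a i b with opp i Fin.≟ opp i | statusAt a i b (opp i)
  ... | yes _ | status = status
  ... | no ≢  | _ = contradiction refl ≢

  keep≢blocked : ∀ {e : Entry hubs} → e ≡ keep → ¬ Has blocked e
  keep≢blocked refl ()

  freeEntry : ∀ c d → entry c d ≡ free → LeaveAdj (decode c) (decode d)
  freeEntry (at a i) (at b j) eq with j Fin.≟ opp i | statusLaw (at a i) (at b j)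
  ... | no _     | ≢free = contradiction eq ≢free
  ... | yes refl | status with twisted i in tw
  freeEntry (at a i) (at b j) eq | yes refl | status | false with a Fin.≟ b
  ... | yes _ = contradiction eq status
  ... | no _  = contradiction (trans (sym eq) status) λ ()
  freeEntry (at 0F i) (at 0F j) eq | yes refl | status | true = contradiction eq status
  freeEntry (at 0F i) (at (suc b) j) eq | yes refl | status | true rewrite eq = ⊥-elim status
  freeEntry (at (suc a) i) (at 0F j) eq | yes refl | status | true rewrite eq = ⊥-elim status
  freeEntry (at (suc a) i) (at (suc b) j) eq | yes refl | status | true with a Fin.≟ b
  ... | no _ = contradiction (trans (sym eq) status) λ ()
  freeEntry (at 1F i) (at 1F j) eq | yes refl | status | true | yes _ =
    opposite i (subst (λ t → Edge t p p) (sym tw) loop-p)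
  freeEntry (at 2F i) (at 2F j) eq | yes refl | status | true | yes _ =
    opposite i (subst (λ t → Edge t q q) (sym tw) loop-q)
  freeEntry (at a i) (hub r) eq = contradiction eq (statusLaw (at a i) (hub r))
  freeEntry (hub r) (at a i) eq = contradiction eq (statusLaw (hub r) (at a i))
  freeEntry (hub r) (hub t) eq with r Fin.≟ t | statusLaw (hub r) (hub t)
  ... | yes _ | ≡keep = contradiction (trans (sym eq) ≡keep) λ ()
  ... | no _  | status with hubEdge r t
  ...   | true  = contradiction (trans (sym eq) status) λ ()
  ...   | false rewrite eq = ⊥-elim status

  keptOpposite : ∀ {x y} i → x ≢ y → Kept (at x i) (at y (opp i)) → Edge (twisted i) x y
  keptOpposite {x} {y} i x≢y k with twisted i in tw
  ... | false = plain x≢y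
  ... | true  = far x≢y λ t → touched t k
    where
    blockedPair : ∀ a b → oppStatus true a b ≡ blocked → ¬ Kept (at (pos a) i) (at (pos b) (opp i))
    blockedPair a b ≡blocked k = keep≢blocked (k {at a i} {at b (opp i)} refl refl)
      (subst (λ s → Has s (entry (at a i) (at b (opp i))))
        (trans (cong (λ t → oppStatus t a b) tw) ≡blocked) (statusOpp a i b))
    touched : ∀ {x y} → Touch x y → ¬ Kept (at x i) (at y (opp i))
    touched o-p = blockedPair 0F 1F refl
    touched o-q = blockedPair 0F 2F refl
    touched p-o = blockedPair 1F 0F refl
    touched q-o = blockedPair 2F 0F refl

  op-free⁻ : ∀ {a b} → a ≢ b → op a b ≡ nothing → LeaveAdj a b
  op-free⁻ {a} {b} a≢b eq with opView a b
  ... | changed c d ≢keep with entry c d in entry≡ | trans (sym (op-decode c d)) eq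
  ...   | keep | _ = contradiction refl ≢keep
  ...   | free | _ = freeEntry c d entry≡
  op-free⁻ {a} {b} a≢b eq | kept k with pairView a b | trans (sym (op-kept k)) eq
  ... | across {x} {y} i j x≢y | none≡ with kind i j | kindLaw i j | trans (sym (base-cross i j x≢y)) none≡
  ...   | none        | refl | _ = opposite i (keptOpposite i x≢y k)
  ...   | meanTo _    | _    | ()
  ...   | midFirst _  | _    | ()
  ...   | midSecond _ | _    | ()
  op-free⁻ a≢b eq | kept k | local x l m | none≡ with line l m | lineLaw l m | trans (sym (base-local x l m)) none≡
  ...   | nothing | inj₁ refl | _ = contradiction refl a≢b
  op-free⁻ a≢b eq | kept k | local x (inj₂ r) (inj₂ t) | none≡ | nothing | inj₂ _ | _
    with r Fin.≟ t | statusLaw (hub r) (hub t)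
  ... | yes refl | _ = contradiction refl a≢b
  ... | no _ | status with hubEdge r t in edge
  ...   | true  = between edge
  ...   | false = contradiction status (keep≢blocked (k {hub r} {hub t} refl refl))

  edge-kept : ∀ i a b → Edge (twisted i) (pos a) (pos b) →
              entry (at a i) (at b (opp i)) ≢ free → entry (at a i) (at b (opp i)) ≡ keep
  edge-kept i a b e ≢free with twisted i | statusOpp a i b | e
  ... | false | status | plain a≢b with a Fin.≟ b
  ...   | yes refl = contradiction refl a≢b
  ...   | no _ = status
  edge-kept i 0F 0F e ≢free | true | status | far a≢b _ = contradiction refl a≢b
  edge-kept i 0F 1F e ≢free | true | status | far _ ¬t = contradiction o-p ¬t
  edge-kept i 0F 2F e ≢free | true | status | far _ ¬t = contradiction o-q ¬t
  edge-kept i 1F 0F e ≢free | true | status | far _ ¬t = contradiction p-o ¬t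
  edge-kept i 2F 0F e ≢free | true | status | far _ ¬t = contradiction q-o ¬t
  edge-kept i (suc a) (suc b) e ≢free | true | status | _ with a Fin.≟ b
  ... | yes _ = contradiction status ≢free
  ... | no _ = status

  leaveEntry : ∀ c d → LeaveAdj (decode c) (decode d) → entry c d ≢ keep → entry c d ≡ free
  leaveEntry (at a i) (at b _) (opposite .i e) ≢keep with entry (at a i) (at b (opp i)) ≟ᵉ free
  ... | yes ≡free = ≡free
  ... | no ≢free = contradiction (edge-kept i a b e ≢free) ≢keep
  leaveEntry (hub r) (hub t) (between e) ≢keep with r Fin.≟ t | statusLaw (hub r) (hub t)
  ... | yes _ | ≡keep = contradiction ≡keep ≢keep
  ... | no _ | status rewrite e = contradiction status ≢keep

  op-free⁺ : ∀ {a b} → LeaveAdj a b → op a b ≡ nothing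
  op-free⁺ {a} {b} adj with opView a b
  ... | changed c d ≢keep = trans (op-decode c d)
    (cong (λ e → override e (base (decode c) (decode d))) (leaveEntry c d adj ≢keep))
  ... | kept k = trans (op-kept k) (base-free adj k)
    where
    loop : ∀ a i → oppStatus (twisted i) (suc a) (suc a) ≡ freed →
           ¬ Kept (at (pos (suc a)) i) (at (pos (suc a)) (opp i))
    loop a i ≡freed k = contradiction
      (trans (sym (k {at (suc a) i} {at (suc a) (opp i)} refl refl))
        (subst (λ s → Has s (entry (at (suc a) i) (at (suc a) (opp i)))) ≡freed (statusOpp (suc a) i (suc a))))
      λ ()
    apart : ∀ {x y} i → x ≢ y → base (at x i) (at y (opp i)) ≡ nothing
    apart {x} {y} i x≢y = trans (base-cross i (opp i) x≢y) (cong (λ e → cross e x y) (kind-opp i))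
    base-free : ∀ {a b} → LeaveAdj a b → Kept a b → base a b ≡ nothing
    base-free (between _) _ = refl
    base-free (opposite {x} {y} i e) k with twisted i in tw | e
    ... | false | plain x≢y = apart i x≢y
    ... | true  | far x≢y _ = apart i x≢y
    ... | true  | loop-p    = ⊥-elim (loop 0F i (cong (λ t → oppStatus t 1F 1F) tw) λ {c} {d} → k {c} {d})
    ... | true  | loop-q    = ⊥-elim (loop 1F i (cong (λ t → oppStatus t 2F 2F) tw) λ {c} {d} → k {c} {d})

-- Degrees and colours of the twisted graph

-- Duplicate-free lists with the same members are permutations of each other; all degrees and edge
-- numbers of graphs below are found by exhibiting such a list.
length-filter-≡ : ∀ {A : Set} {P : A → Set} (P? : Decidable P) {xs ys} → Unique xs → Unique ys →
  (∀ {z} → z ∈ˡ ys → P z → z ∈ˡ xs) → (∀ {z} → z ∈ˡ xs → z ∈ˡ ys × P z) →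
  length (filter P? ys) ≡ length xs
length-filter-≡ P? {xs} {ys} xs! ys! complete sound = ↭-length (∼bag⇒↭ (unique∧set⇒bag
  (Unique.filter⁺ P? ys!) xs!
  (mk⇔ (λ z∈ → let z∈ys , Pz = ∈-filter⁻ P? {xs = ys} z∈ in complete z∈ys Pz)
       (λ z∈ → let z∈ys , Pz = sound z∈ in ∈-filter⁺ P? z∈ys Pz))))

length-filter-map : ∀ {A B : Set} {P : B → Set} (P? : Decidable P) (f : A → B) xs →
  length (filter P? (map f xs)) ≡ length (filter (P? ∘ f) xs)
length-filter-map P? f [] = refl
length-filter-map P? f (x ∷ xs) with does (P? (f x))
... | true  = cong suc (length-filter-map P? f xs)
... | false = length-filter-map P? f xs

length-filter-cartesianProduct : ∀ {A B : Set} {P : A × B → Set} (P? : Decidable P) xs ys →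
  length (filter P? (cartesianProduct xs ys)) ≡ sum (map (λ x → length (filter (λ y → P? (x , y)) ys)) xs)
length-filter-cartesianProduct P? [] ys = refl
length-filter-cartesianProduct P? (x ∷ xs) ys = begin
  length (filter P? (map (x ,_) ys ++ cartesianProduct xs ys))
    ≡⟨ cong length (List.filter-++ P? (map (x ,_) ys) _) ⟩
  length (filter P? (map (x ,_) ys) ++ filter P? (cartesianProduct xs ys))
    ≡⟨ List.length-++ (filter P? (map (x ,_) ys)) ⟩
  length (filter P? (map (x ,_) ys)) + length (filter P? (cartesianProduct xs ys))
    ≡⟨ cong₂ _+_ (length-filter-map P? (x ,_) ys) (length-filter-cartesianProduct P? xs ys) ⟩
  length (filter (λ y → P? (x , y)) ys) + sum (map (λ x → length (filter (λ y → P? (x , y)) ys)) xs) ∎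
  where open ≡-Reasoning

sum-tabulate-const : ∀ {n c} (f : Fin n → ℕ) → (∀ i → f i ≡ c) → sum (tabulate f) ≡ n * c
sum-tabulate-const {zero}  f const = refl
sum-tabulate-const {suc n} f const = cong₂ _+_ (const zero) (sum-tabulate-const (f ∘ suc) (const ∘ suc))

odd : ℕ → Bool
odd zero    = false
odd (suc n) = not (odd n)

odd-double : ∀ n → odd (n * 2) ≡ false
odd-double zero    = refl
odd-double (suc n) = cong (not ∘ not) (odd-double n)

module EdgeProperties (h : ℕ) where
  open Residues h
  open Edges h

  touch? : ∀ x y → Dec (Touch x y)
  touch? x y with x Fin.≟ o | y Fin.≟ o | x Fin.≟ p | x Fin.≟ q | y Fin.≟ p | y Fin.≟ q
  ... | yes refl | _        | _        | _        | yes refl | _        = yes o-p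
  ... | yes refl | _        | _        | _        | no _     | yes refl = yes o-q
  ... | yes refl | _        | _        | _        | no y≢p   | no y≢q   = no λ { o-p → y≢p refl ; o-q → y≢q refl }
  ... | no _     | yes refl | yes refl | _        | _        | _        = yes p-o
  ... | no _     | yes refl | no _     | yes refl | _        | _        = yes q-o
  ... | no _     | yes refl | no x≢p   | no x≢q   | _        | _        = no λ { p-o → x≢p refl ; q-o → x≢q refl }
  ... | no x≢o   | no y≢o   | _        | _        | _        | _        =
    no λ { o-p → x≢o refl ; o-q → x≢o refl ; p-o → y≢o refl ; q-o → y≢o refl }

  edge? : ∀ t x y → Dec (Edge t x y)
  edge? false x y with x Fin.≟ y
  ... | yes refl = no λ { (plain x≢x) → x≢x refl }
  ... | no x≢y = yes (plain x≢y)
  edge? true x y with x Fin.≟ y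
  edge? true x y | no x≢y with touch? x y
  ... | no ¬t = yes (far x≢y ¬t)
  ... | yes t = no λ { (far _ ¬t) → ¬t t ; loop-p → x≢y refl ; loop-q → x≢y refl }
  edge? true x .x | yes refl with x Fin.≟ p | x Fin.≟ q
  ... | yes refl | _ = yes loop-p
  ... | no _ | yes refl = yes loop-q
  ... | no x≢p | no x≢q = no λ { (far x≢x _) → x≢x refl ; loop-p → x≢p refl ; loop-q → x≢q refl }

  -- Exactly one position f is not a neighbour of x, so the degree is w. In the twisted graph f is o
  -- when x is p or q.
  Row : Bool → Fin N → Set
  Row t x = ∃[ f ] (∀ y → y ≢ f → Edge t x y) × ¬ Edge t x f

  plain-row : ∀ x → Row false x
  plain-row x = x , (λ y y≢x → plain (y≢x ∘ sym)) , λ { (plain x≢x) → x≢x refl }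

  twisted-row : ∀ x → x ≢ o → Row true x
  twisted-row x x≢o with x Fin.≟ p | x Fin.≟ q
  ... | yes refl | _ = o , edge , λ { (far _ ¬t) → ¬t p-o }
    where
    edge : ∀ y → y ≢ o → Edge true p y
    edge y y≢o with y Fin.≟ p
    ... | yes refl = loop-p
    ... | no y≢p = far (y≢p ∘ sym) λ { p-o → y≢o refl }
  ... | no _ | yes refl = o , edge , λ { (far _ ¬t) → ¬t q-o }
    where
    edge : ∀ y → y ≢ o → Edge true q y
    edge y y≢o with y Fin.≟ q
    ... | yes refl = loop-q
    ... | no y≢q = far (y≢q ∘ sym) λ { q-o → y≢o refl }
  ... | no x≢p | no x≢q = x ,
    (λ y y≢x → far (y≢x ∘ sym) λ { o-p → x≢o refl ; o-q → x≢o refl ; p-o → x≢p refl ; q-o → x≢q refl }) ,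
    λ { (far x≢x _) → x≢x refl ; loop-p → x≢p refl ; loop-q → x≢q refl }

  row-length : ∀ {t x} → Row t x → length (filter (edge? t x) (allFin N)) ≡ w
  row-length {t} {x} (f , edge , ¬edge) = trans
    (length-filter-≡ (edge? t x)
      (Unique.map⁺ {f = punchIn f} (λ {i} {j} → Fin.punchIn-injective f i j) (Unique.allFin⁺ w))
      (Unique.allFin⁺ N)
      (λ {y} _ e → subst (_∈ˡ map (punchIn f) (allFin w))
        (Fin.punchIn-punchOut (λ f≡y → ¬edge (subst (Edge t x) (sym f≡y) e)))
        (∈-map⁺ (punchIn f) (∈-allFin _)))
      (λ y∈ → let i , _ , eq = ∈-map⁻ (punchIn f) y∈ in
        ∈-allFin _ , subst (Edge t x) (sym eq) (edge (punchIn f i) (Fin.punchInᵢ≢i f i))))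
    (trans (List.length-map (punchIn f) (allFin w)) (List.length-tabulate (λ i → i)))

  last : Fin (suc (h * 2))
  last = fromℕ (h * 2)

  -- Enumerates the positions other than 0, 1 and w, which are the neighbours of o in the twisted
  -- graph.
  beyond : Fin (h * 2) → Fin N
  beyond i = suc (suc (punchIn last i))

  o-row-length : length (filter (edge? true o) (allFin N)) ≡ h * 2
  o-row-length = trans
    (length-filter-≡ (edge? true o)
      (Unique.map⁺ {f = beyond} (λ eq → Fin.punchIn-injective last _ _ (Fin.suc-injective (Fin.suc-injective eq)))
        (Unique.allFin⁺ (h * 2)))
      (Unique.allFin⁺ N) (λ _ → complete)
      (λ y∈ → let i , _ , eq = ∈-map⁻ beyond y∈ in ∈-allFin _ , subst (Edge true o) (sym eq) (sound i)))
    (trans (List.length-map beyond (allFin (h * 2))) (List.length-tabulate (λ i → i)))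
    where
    sound : ∀ i → Edge true o (beyond i)
    sound i = far (λ ()) λ t → notTouch t refl refl
      where
      notTouch : ∀ {x y} → Touch x y → x ≡ o → y ≢ beyond i
      notTouch o-q _ eq = Fin.punchInᵢ≢i last i (sym (Fin.suc-injective (Fin.suc-injective eq)))
    complete : ∀ {y} → Edge true o y → y ∈ˡ map beyond (allFin (h * 2))
    complete {zero} (far x≢x _) = contradiction refl x≢x
    complete {suc zero} (far _ ¬t) = contradiction o-p ¬t
    complete {suc (suc y)} (far _ ¬t) =
      subst (λ z → suc (suc z) ∈ˡ map beyond (allFin (h * 2)))
        (Fin.punchIn-punchOut (λ last≡y → ¬t (subst (λ z → Touch o (suc (suc z))) last≡y o-q)))
        (∈-map⁺ beyond (∈-allFin _))

  -- The two coordinates belong to different levels, so x y and y x are different edges and x x is a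
  -- genuine one.
  edges : ∀ t → List (Fin N × Fin N)
  edges t = filter (λ (x , y) → edge? t x y) (cartesianProduct (allFin N) (allFin N))

  edgeCount : Bool → ℕ
  edgeCount false = N * w
  edgeCount true  = h * 2 + w * w

  edges-length : ∀ t → length (edges t) ≡ edgeCount t
  edges-length t = trans (length-filter-cartesianProduct (λ (x , y) → edge? t x y) (allFin N) (allFin N))
    (trans (cong sum (List.map-tabulate (λ x → x) rowLength)) (total t))
    where
    rowLength : Fin N → ℕ
    rowLength x = length (filter (edge? t x) (allFin N))
    total : ∀ t → sum (tabulate λ x → length (filter (edge? t x) (allFin N))) ≡ edgeCount t
    total false = sum-tabulate-const _ (λ x → row-length (plain-row x))
    total true  = cong₂ _+_ o-row-length (sum-tabulate-const _ (λ x → row-length (twisted-row (suc x) λ ())))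

  -- The twisted graph is coloured by differences, except that the differences
  -- p and q, whose edges at o are missing, are replaced by the alternating
  -- colouring of the path 1 – 2 – … – w, closed by a loop at either end.
  alternate : ℕ → Fin N
  alternate n = if odd n then p else q

  data Short : Fin N → Fin N → Fin N → Set where
    loop : ∀ {x y} → x ≡ y → x ≡ p ⊎ x ≡ q → Short x y q
    up   : ∀ {x y} → x ≢ o → toℕ y ≡ suc (toℕ x) → Short x y (alternate (toℕ x))
    down : ∀ {x y} → y ≢ o → toℕ x ≡ suc (toℕ y) → Short x y (alternate (toℕ y))

  short-sym : ∀ {x y c} → Short x y c → Short y x c
  short-sym (loop x≡y (inj₁ x≡p)) = loop (sym x≡y) (inj₁ (trans (sym x≡y) x≡p))
  short-sym (loop x≡y (inj₂ x≡q)) = loop (sym x≡y) (inj₂ (trans (sym x≡y) x≡q))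
  short-sym (up x≢o eq)   = down x≢o eq
  short-sym (down y≢o eq) = up y≢o eq

  alternate-suc : ∀ n → alternate n ≢ alternate (suc n)
  alternate-suc n eq with odd n
  alternate-suc n () | true
  alternate-suc n () | false

  alternate-pq : ∀ n → alternate n ≡ p ⊎ alternate n ≡ q
  alternate-pq n with odd n
  ... | true = inj₁ refl
  ... | false = inj₂ refl

  short-pq : ∀ {x y c} → Short x y c → c ≡ p ⊎ c ≡ q
  short-pq (loop _ _) = inj₂ refl
  short-pq (up {x} _ _) = alternate-pq (toℕ x)
  short-pq (down {y = y} _ _) = alternate-pq (toℕ y)

  -- Loops have colour q, while the path edges at both ends, 1 - 2 and (w - 1) - w, have colour p
  -- because 1 and w - 1 are odd. This and `loop-down` are where the evenness of w makes the
  -- alternation close up.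
  loop-up : ∀ {x y : Fin N} → x ≡ p ⊎ x ≡ q → toℕ y ≡ suc (toℕ x) → q ≢ alternate (toℕ x)
  loop-up (inj₁ refl) _ ()
  loop-up {y = y} (inj₂ refl) eq _ = ℕ.<-irrefl (trans eq (cong suc (Fin.toℕ-fromℕ w))) (Fin.toℕ<n y)

  loop-down : ∀ {x y} → x ≡ p ⊎ x ≡ q → y ≢ o → toℕ x ≡ suc (toℕ y) → q ≢ alternate (toℕ y)
  loop-down {y = zero} (inj₁ refl) y≢o eq _ = y≢o refl
  loop-down {y = suc y} (inj₁ refl) _ ()
  loop-down {y = y} (inj₂ refl) y≢o eq q≡ =
    contradiction (trans q≡ (cong alternate (ℕ.suc-injective (trans (sym eq) (Fin.toℕ-fromℕ w))))) q≢alternate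
    where
    q≢alternate : q ≢ alternate (suc (h * 2))
    q≢alternate rewrite odd-double h = λ ()

  short-unique : ∀ {x y z c d} → Short x y c → Short x z d → c ≡ d → y ≡ z
  short-unique (loop refl _) (loop refl _) _ = refl
  short-unique (loop refl e) (up _ eq) c≡d = contradiction c≡d (loop-up e eq)
  short-unique (loop refl e) (down z≢o eq) c≡d = contradiction c≡d (loop-down e z≢o eq)
  short-unique (up _ eq) (loop refl e) c≡d = contradiction (sym c≡d) (loop-up e eq)
  short-unique (up _ eq) (up _ eq′) _ = Fin.toℕ-injective (trans eq (sym eq′))
  short-unique (up _ eq) (down {y = z} _ eq′) c≡d =
    contradiction (trans (sym c≡d) (cong alternate eq′)) (alternate-suc (toℕ z))
  short-unique (down y≢o eq) (loop refl e) c≡d = contradiction (sym c≡d) (loop-down e y≢o eq)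
  short-unique (down {y = y} _ eq) (up _ eq′) c≡d =
    contradiction (trans c≡d (cong alternate eq)) (alternate-suc (toℕ y))
  short-unique (down _ eq) (down _ eq′) _ = Fin.toℕ-injective (ℕ.suc-injective (trans (sym eq) eq′))

  ⊖-o : ∀ {x y} → y ⊖ x ≡ o → x ≡ y
  ⊖-o {x} {y} eq = trans (sym (⊕-identityʳ x)) (trans (cong (x ⊕_) (sym eq)) (⊕-⊖ x y))

  -- The exceptional pair, from w to 0, is one that the twisted graph omits; so its edges of
  -- difference 1 all run along the path.
  ⊖-p : ∀ {x y} → y ⊖ x ≡ p → toℕ y ≡ suc (toℕ x) ⊎ (x ≡ q × y ≡ o)
  ⊖-p {x} {y} eq with refl ← trans (cong (x ⊕_) (sym eq)) (⊕-⊖ x y) = ⊕-p x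

  ⊖-q : ∀ {x y} → y ⊖ x ≡ q → toℕ x ≡ suc (toℕ y) ⊎ (y ≡ q × x ≡ o)
  ⊖-q {x} {y} eq with refl ← trans (cong (x ⊕_) (sym eq)) (⊕-⊖ x y) with ⊕-p (x ⊕ q)
  ... | inj₁ toℕ≡ = inj₁ (trans (cong toℕ (sym (⊕-q-p x))) toℕ≡)
  ... | inj₂ (≡q , ≡o) = inj₂ (≡q , trans (sym (⊕-q-p x)) ≡o)

  data Long : Fin N → Fin N → Fin N → Set where
    long : ∀ {x y} → x ≢ y → y ⊖ x ≢ p → y ⊖ x ≢ q → Long x y (y ⊖ x)

  Coloured : Fin N → Fin N → Fin N → Set
  Coloured x y c = Short x y c ⊎ Long x y c

  twistedColour : Fin N → Fin N → Fin N
  twistedColour x y with x Fin.≟ y | toℕ y ℕ.≟ suc (toℕ x) | toℕ x ℕ.≟ suc (toℕ y)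
  ... | yes _ | _     | _     = q
  ... | no _  | yes _ | _     = alternate (toℕ x)
  ... | no _  | no _  | yes _ = alternate (toℕ y)
  ... | no _  | no _  | no _  = y ⊖ x

  twisted-coloured : ∀ {x y} → Edge true x y → Coloured x y (twistedColour x y)
  twisted-coloured {x} {y} e with x Fin.≟ y | toℕ y ℕ.≟ suc (toℕ x) | toℕ x ℕ.≟ suc (toℕ y)
  twisted-coloured loop-p | yes _ | _ | _ = inj₁ (loop refl (inj₁ refl))
  twisted-coloured loop-q | yes _ | _ | _ = inj₁ (loop refl (inj₂ refl))
  twisted-coloured (far x≢y _) | yes x≡y | _ | _ = contradiction x≡y x≢y
  twisted-coloured {x} {y} (far _ ¬t) | no _ | yes eq | _ = inj₁ (up (λ x≡o → o-up x≡o eq) eq)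
    where
    o-up : x ≡ o → toℕ y ≢ suc (toℕ x)
    o-up refl eq = ¬t (subst (Touch o) (Fin.toℕ-injective (sym eq)) o-p)
  twisted-coloured {x} {y} (far _ ¬t) | no _ | no _ | yes eq = inj₁ (down (λ y≡o → o-down y≡o eq) eq)
    where
    o-down : y ≡ o → toℕ x ≢ suc (toℕ y)
    o-down refl eq = ¬t (subst (λ z → Touch z o) (Fin.toℕ-injective (sym eq)) p-o)
  twisted-coloured {x} {y} (far x≢y ¬t) | no _ | no ¬up | no ¬down = inj₂ (long x≢y ≢p ≢q)
    where
    ≢p : y ⊖ x ≢ p
    ≢p eq with ⊖-p eq
    ... | inj₁ toℕy≡ = ¬up toℕy≡
    ... | inj₂ (refl , refl) = ¬t q-o
    ≢q : y ⊖ x ≢ q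
    ≢q eq with ⊖-q eq
    ... | inj₁ toℕx≡ = ¬down toℕx≡
    ... | inj₂ (refl , refl) = ¬t o-q
  twisted-coloured loop-p | no x≢x | _ | _ = contradiction refl x≢x
  twisted-coloured loop-q | no x≢x | _ | _ = contradiction refl x≢x

  coloured-≢o : ∀ {x y c} → Coloured x y c → c ≢ o
  coloured-≢o (inj₁ s) refl with short-pq s
  ... | inj₁ ()
  ... | inj₂ ()
  coloured-≢o (inj₂ (long x≢y _ _)) eq = x≢y (⊖-o eq)

  short≢long : ∀ {x y u v c d} → Short x y c → Long u v d → c ≢ d
  short≢long s (long _ ≢p ≢q) refl with short-pq s
  ... | inj₁ ≡p = ≢p ≡p
  ... | inj₂ ≡q = ≢q ≡q

  coloured-rowUnique : ∀ {x y z c d} → Coloured x y c → Coloured x z d → c ≡ d → y ≡ z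
  coloured-rowUnique (inj₁ s) (inj₁ s′) eq = short-unique s s′ eq
  coloured-rowUnique (inj₁ s) (inj₂ l) eq = contradiction eq (short≢long s l)
  coloured-rowUnique (inj₂ l) (inj₁ s) eq = contradiction (sym eq) (short≢long s l)
  coloured-rowUnique (inj₂ (long _ _ _)) (inj₂ (long _ _ _)) eq = ⊖-injectiveʳ eq

  coloured-columnUnique : ∀ {x y z c d} → Coloured x z c → Coloured y z d → c ≡ d → x ≡ y
  coloured-columnUnique (inj₁ s) (inj₁ s′) eq = short-unique (short-sym s) (short-sym s′) eq
  coloured-columnUnique (inj₁ s) (inj₂ l) eq = contradiction eq (short≢long s l)
  coloured-columnUnique (inj₂ l) (inj₁ s) eq = contradiction (sym eq) (short≢long s l)
  coloured-columnUnique (inj₂ (long _ _ _)) (inj₂ (long _ _ _)) eq = ⊖-injectiveˡ eq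

  colourN : Bool → Fin N → Fin N → Fin N
  colourN false x y = y ⊖ x
  colourN true  x y = twistedColour x y

  colourN-≢o : ∀ {t x y} → Edge t x y → colourN t x y ≢ o
  colourN-≢o {false} (plain x≢y) eq = x≢y (⊖-o eq)
  colourN-≢o {true} e = coloured-≢o (twisted-coloured e)

  -- The difference 0 does not occur as a colour, so its value is immaterial.
  dropZero : Fin N → Fin w
  dropZero zero    = zero
  dropZero (suc c) = c

  dropZero-injective : ∀ {c d} → c ≢ o → d ≢ o → dropZero c ≡ dropZero d → c ≡ d
  dropZero-injective {zero}  {_}     c≢o _   _  = contradiction refl c≢o
  dropZero-injective {suc c} {zero}  _   d≢o _  = contradiction refl d≢o
  dropZero-injective {suc c} {suc d} _   _   eq = cong suc eq

  colour : Bool → Fin N → Fin N → Fin w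
  colour t x y = dropZero (colourN t x y)

  colour-rowUnique : ∀ {t x y z} → Edge t x y → Edge t x z → colour t x y ≡ colour t x z → y ≡ z
  colour-rowUnique {t} e e′ eq = unique e e′ (dropZero-injective (colourN-≢o e) (colourN-≢o e′) eq)
    where
    unique : ∀ {t x y z} → Edge t x y → Edge t x z → colourN t x y ≡ colourN t x z → y ≡ z
    unique {false} _ _ eq = ⊖-injectiveʳ eq
    unique {true} e e′ eq = coloured-rowUnique (twisted-coloured e) (twisted-coloured e′) eq

  colour-columnUnique : ∀ {t x y z} → Edge t x z → Edge t y z → colour t x z ≡ colour t y z → x ≡ y
  colour-columnUnique {t} e e′ eq = unique e e′ (dropZero-injective (colourN-≢o e) (colourN-≢o e′) eq)
    where
    unique : ∀ {t x y z} → Edge t x z → Edge t y z → colourN t x z ≡ colourN t y z → x ≡ y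
    unique {false} _ _ eq = ⊖-injectiveˡ eq
    unique {true} e e′ eq = coloured-columnUnique (twisted-coloured e) (twisted-coloured e′) eq

-- The leave on numbered vertices: degrees, edges and colouring

transport : ∀ {A B : Set} {op : A → A → Maybe A} (f : A → B) (g : B → A) →
  (∀ x → g (f x) ≡ x) → (∀ y → f (g y) ≡ y) →
  PartialSteiner op → PartialSteiner (λ x y → Maybe.map f (op (g x) (g y)))
transport {op = op} f g gf fg isPS = record { op-comm = comm ; op-swap = swap ; op-diag = diag }
  where
  open PartialSteiner isPS
  comm : ∀ {x y z} → Maybe.map f (op (g x) (g y)) ≡ just z → Maybe.map f (op (g y) (g x)) ≡ just z
  comm {x} {y} eq with op (g x) (g y) in xy
  comm refl | just c = cong (Maybe.map f) (op-comm xy)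
  swap : ∀ {x y z} → Maybe.map f (op (g x) (g y)) ≡ just z → Maybe.map f (op (g x) (g z)) ≡ just y
  swap {x} {y} eq with op (g x) (g y) in xy
  swap {x} {y} refl | just c =
    trans (cong (Maybe.map f) (trans (cong (op (g x)) (gf c)) (op-swap xy))) (cong just (fg y))
  diag : ∀ x → Maybe.map f (op (g x) (g x)) ≡ nothing
  diag x = cong (Maybe.map f) (op-diag (g x))

module Assembly (h : ℕ) (seed : SeedData) (lawful : SeedData.Lawful seed) (4≤w : 4 ≤ suc h * 2) where
  open Construction h seed lawful
  open EdgeProperties h

  u : ℕ
  u = 6 * N + hubs

  encode : P → Fin u
  encode (at x i) = combine i x ↑ˡ hubs
  encode (hub r)  = 6 * N ↑ʳ r

  point : Fin (6 * N) ⊎ Fin hubs → P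
  point (inj₁ k) = at (proj₂ (remQuot {6} N k)) (proj₁ (remQuot {6} N k))
  point (inj₂ r) = hub r

  pointAt : Fin u → P
  pointAt v = point (splitAt (6 * N) v)

  pointAt-encode : ∀ a → pointAt (encode a) ≡ a
  pointAt-encode (at x i) = trans (cong point (Fin.splitAt-↑ˡ (6 * N) (combine i x) hubs))
    (cong (λ (i , x) → at x i) (Fin.remQuot-combine i x))
  pointAt-encode (hub r) = cong point (Fin.splitAt-↑ʳ (6 * N) hubs r)

  encode-pointAt : ∀ v → encode (pointAt v) ≡ v
  encode-pointAt v with splitAt (6 * N) v in eq
  ... | inj₁ k = trans (cong (_↑ˡ hubs) (Fin.combine-remQuot {6} N k)) (Fin.splitAt⁻¹-↑ˡ eq)
  ... | inj₂ r = Fin.splitAt⁻¹-↑ʳ eq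

  encode-injective : ∀ {a b} → encode a ≡ encode b → a ≡ b
  encode-injective {a} {b} eq = trans (sym (pointAt-encode a)) (trans (cong pointAt eq) (pointAt-encode b))

  opᵘ : Fin u → Fin u → Maybe (Fin u)
  opᵘ v v′ = Maybe.map encode (op (pointAt v) (pointAt v′))

  open Blocks {op = opᵘ} (transport encode pointAt pointAt-encode encode-pointAt op-isPartialSteiner)
    using (system; leave-adj⁻; leave-adj⁺) public

  L : Graph u
  L = leave system

  adj⁻ : ∀ {v v′} → Adj L v v′ → LeaveAdj (pointAt v) (pointAt v′)
  adj⁻ {v} {v′} adj with v≢v′ , eq ← leave-adj⁻ {v} {v′} adj =
    op-free⁻ (λ same → v≢v′ (trans (sym (encode-pointAt v)) (trans (cong encode same) (encode-pointAt v′))))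
             (none-map eq)
    where
    none-map : ∀ {m} → Maybe.map encode m ≡ nothing → m ≡ nothing
    none-map {nothing} _ = refl

  adj⁺ : ∀ {a b} → LeaveAdj a b → Adj L (encode a) (encode b)
  adj⁺ {a} {b} adj = leave-adj⁺ (λ eq → LeaveAdj-≢ adj (encode-injective {a} {b} eq))
    (cong (Maybe.map encode) (trans (cong₂ op (pointAt-encode a) (pointAt-encode b)) (op-free⁺ adj)))

  adjᵉ : ∀ {a v} → Adj L (encode a) v → LeaveAdj a (pointAt v)
  adjᵉ {a} adj = subst (λ b → LeaveAdj b _) (pointAt-encode a) (adj⁻ adj)

  row-even : ∀ t x → length (filter (edge? t x) (allFin N)) % 2 ≡ 0
  row-even false x = trans (cong (_% 2) (row-length (plain-row x))) (m*n%n≡0 (suc h) 2)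
  row-even true x = twisted-even (x Fin.≟ o)
    where
    twisted-even : Dec (x ≡ o) → length (filter (edge? true x) (allFin N)) % 2 ≡ 0
    twisted-even (yes x≡o) = trans (cong (λ x → length (filter (edge? true x) (allFin N)) % 2) x≡o)
                                   (trans (cong (_% 2) o-row-length) (m*n%n≡0 h 2))
    twisted-even (no x≢o)  = trans (cong (_% 2) (row-length (twisted-row x x≢o))) (m*n%n≡0 (suc h) 2)

  at-injective : ∀ {x y i j} → _≡_ {A = P} (at x i) (at y j) → x ≡ y
  at-injective refl = refl

  hub-injective : ∀ {r t} → _≡_ {A = P} (hub r) (hub t) → r ≡ t
  hub-injective refl = refl

  opposite⁻ : ∀ {x i b} → LeaveAdj (at x i) b → ∃[ y ] b ≡ at y (opp i) × Edge (twisted i) x y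
  opposite⁻ (opposite i e) = _ , refl , e

  between⁻ : ∀ {r b} → LeaveAdj (hub r) b → ∃[ t ] b ≡ hub t × hubEdge r t ≡ true
  between⁻ (between e) = _ , refl , e

  encode≡ : ∀ {a v} → pointAt v ≡ a → encode a ≡ v
  encode≡ {a} {v} eq = trans (cong encode (sym eq)) (encode-pointAt v)

  deg-even : ∀ v → deg L v % 2 ≡ 0
  deg-even v = subst (λ v → deg L v % 2 ≡ 0) (encode-pointAt v) (deg-encode (pointAt v))
    where
    deg-encode : ∀ a → deg L (encode a) % 2 ≡ 0
    deg-encode (at x i) = trans (cong (_% 2) (trans
      (length-filter-≡ (adj? L (encode (at x i)))
        (Unique.map⁺ {f = neighbour} neighbour-injective (Unique.filter⁺ (edge? (twisted i) x) (Unique.allFin⁺ N)))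
        (Unique.allFin⁺ u)
        (λ {v} _ adj → let y , eq , e = opposite⁻ (adjᵉ adj) in
          subst (_∈ˡ map neighbour row) (encode≡ eq)
            (∈-map⁺ neighbour (∈-filter⁺ (edge? (twisted i) x) (∈-allFin y) e)))
        (λ v∈ → let y , y∈ , eq = ∈-map⁻ neighbour v∈ in
          ∈-allFin _ , subst (Adj L (encode (at x i))) (sym eq)
            (adj⁺ (opposite i (proj₂ (∈-filter⁻ (edge? (twisted i) x) {xs = allFin N} y∈))))))
      (List.length-map neighbour row)))
      (row-even (twisted i) x)
      where
      row = filter (edge? (twisted i) x) (allFin N)
      neighbour : Fin N → Fin u
      neighbour y = encode (at y (opp i))
      neighbour-injective : ∀ {y z} → neighbour y ≡ neighbour z → y ≡ z
      neighbour-injective {y} {z} eq = at-injective (encode-injective {at y (opp i)} {at z (opp i)} eq)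
    deg-encode (hub r) = trans (cong (_% 2) (trans
      (length-filter-≡ (adj? L (encode (hub r)))
        (Unique.map⁺ {f = encode ∘ inj₂} (λ {r} {t} eq → hub-injective (encode-injective {hub r} {hub t} eq))
          (Unique.filter⁺ hubEdge? (Unique.allFin⁺ hubs)))
        (Unique.allFin⁺ u)
        (λ {v} _ adj → let t , eq , e = between⁻ (adjᵉ adj) in
          subst (_∈ˡ map (encode ∘ inj₂) (hubNeighbours r)) (encode≡ eq)
            (∈-map⁺ (encode ∘ inj₂) (∈-filter⁺ hubEdge? (∈-allFin t) e)))
        (λ v∈ → let t , t∈ , eq = ∈-map⁻ (encode ∘ inj₂) v∈ in
          ∈-allFin _ , subst (Adj L (encode (hub r))) (sym eq)
            (adj⁺ (between (proj₂ (∈-filter⁻ hubEdge? {xs = allFin hubs} t∈))))))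
      (List.length-map (encode ∘ inj₂) (hubNeighbours r))))
      (hubNeighbours-even r)
      where hubEdge? = λ t → hubEdge r t ≟ᵇ true

  lower : List (Fin 6)
  lower = 0F ∷ 1F ∷ 2F ∷ []

  LevelEdge : Fin 6 × Fin N × Fin N → Set
  LevelEdge (i , x , y) = Edge (twisted i) x y

  levelEdge? : ∀ e → Dec (LevelEdge e)
  levelEdge? (i , x , y) = edge? (twisted i) x y

  positionPairs : List (Fin N × Fin N)
  positionPairs = cartesianProduct (allFin N) (allFin N)

  levelEdges : List (Fin 6 × Fin N × Fin N)
  levelEdges = filter levelEdge? (cartesianProduct lower positionPairs)

  levelPair : Fin 6 × Fin N × Fin N → Fin u × Fin u
  levelPair (i , x , y) = encode (at x i) , encode (at y (opp i))

  hubPair : Fin hubs × Fin hubs → Fin u × Fin u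
  hubPair (r , t) = encode (hub r) , encode (hub t)

  -- The numbering is by level first, so starting from the levels 0, 1, 2 lists every edge between
  -- opposite levels once, with its smaller end in front.
  edgeList : List (Fin u × Fin u)
  edgeList = map levelPair levelEdges ++ map hubPair hubEdges

  edgeList-length : length edgeList ≡
    edgeCount (twisted 0F) + (edgeCount (twisted 1F) + (edgeCount (twisted 2F) + 0)) + length hubEdges
  edgeList-length = trans (List.length-++ (map levelPair levelEdges)) (cong₂ _+_
    (trans (List.length-map levelPair levelEdges)
      (trans (length-filter-cartesianProduct levelEdge? lower positionPairs)
        (cong₂ _+_ (edges-length (twisted 0F))
          (cong₂ _+_ (edges-length (twisted 1F)) (cong (_+ 0) (edges-length (twisted 2F)))))))
    (List.length-map hubPair hubEdges))

  edgeList-unique : Unique edgeList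
  edgeList-unique = Unique.++⁺
    (Unique.map⁺ levelPair-injective (Unique.filter⁺ levelEdge?
      (Unique.cartesianProduct⁺ lower-unique (Unique.cartesianProduct⁺ (Unique.allFin⁺ N) (Unique.allFin⁺ N)))))
    (Unique.map⁺ hubPair-injective (Unique.filter⁺ HubEdge?
      (Unique.cartesianProduct⁺ (Unique.allFin⁺ hubs) (Unique.allFin⁺ hubs))))
    λ (e∈ , e∈′) → disjoint (∈-map⁻ levelPair e∈) (∈-map⁻ hubPair e∈′)
    where
    lower-unique : Unique lower
    lower-unique = ((λ ()) ∷ (λ ()) ∷ []) ∷ ((λ ()) ∷ []) ∷ [] ∷ []
    levelPair-injective : ∀ {e f} → levelPair e ≡ levelPair f → e ≡ f
    levelPair-injective {i , x , y} {j , x′ , y′} eq with Product.,-injective eq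
    ... | eq₁ , eq₂ with encode-injective {at x i} {at x′ j} eq₁
                       | encode-injective {at y (opp i)} {at y′ (opp j)} eq₂
    ... | refl | eq₃ = cong (λ y → i , x , y) (at-injective eq₃)
    hubPair-injective : ∀ {e f} → hubPair e ≡ hubPair f → e ≡ f
    hubPair-injective {r , t} {r′ , t′} eq with Product.,-injective eq
    ... | eq₁ , eq₂ with encode-injective {hub r} {hub r′} eq₁ | encode-injective {hub t} {hub t′} eq₂
    ... | refl | refl = refl
    disjoint : ∀ {e} → ∃[ f ] f ∈ˡ levelEdges × e ≡ levelPair f → ¬ (∃[ g ] g ∈ˡ hubEdges × e ≡ hubPair g)
    disjoint ((i , x , y) , _ , refl) ((r , t) , _ , eq) =
      contradiction (encode-injective {at x i} {hub r} (proj₁ (Product.,-injective eq))) λ ()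

  encode-level-< : ∀ {x y i j} → i Fin.< j → encode (at x i) Fin.< encode (at y j)
  encode-level-< {x} {y} {i} {j} i<j =
    subst₂ _<_ (sym (Fin.toℕ-↑ˡ (combine i x) hubs)) (sym (Fin.toℕ-↑ˡ (combine j y) hubs))
      (Fin.combine-monoˡ-< x y i<j)

  encode-hub-<⁺ : ∀ {r t} → r Fin.< t → encode (hub r) Fin.< encode (hub t)
  encode-hub-<⁺ {r} {t} r<t =
    subst₂ _<_ (sym (Fin.toℕ-↑ʳ (6 * N) r)) (sym (Fin.toℕ-↑ʳ (6 * N) t)) (ℕ.+-monoʳ-< (6 * N) r<t)

  encode-hub-<⁻ : ∀ {r t} → encode (hub r) Fin.< encode (hub t) → r Fin.< t
  encode-hub-<⁻ {r} {t} <′ =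
    ℕ.+-cancelˡ-< (6 * N) _ _ (subst₂ _<_ (Fin.toℕ-↑ʳ (6 * N) r) (Fin.toℕ-↑ʳ (6 * N) t) <′)

  lower-< : ∀ {i} → i ∈ˡ lower → i Fin.< opp i
  lower-< (here refl) = s≤s z≤n
  lower-< (there (here refl)) = s≤s (s≤s z≤n)
  lower-< (there (there (here refl))) = s≤s (s≤s (s≤s z≤n))

  lower-or-opp : ∀ i → i ∈ˡ lower ⊎ opp i ∈ˡ lower
  lower-or-opp 0F = inj₁ (here refl)
  lower-or-opp 1F = inj₁ (there (here refl))
  lower-or-opp 2F = inj₁ (there (there (here refl)))
  lower-or-opp 3F = inj₂ (here refl)
  lower-or-opp 4F = inj₂ (there (here refl))
  lower-or-opp 5F = inj₂ (there (there (here refl)))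

  edgeList-complete : ∀ {a b} → LeaveAdj a b → encode a Fin.< encode b → (encode a , encode b) ∈ˡ edgeList
  edgeList-complete (opposite {x} {y} i e) a<b with lower-or-opp i
  ... | inj₁ i∈ = ∈-++⁺ˡ (∈-map⁺ levelPair (∈-filter⁺ levelEdge?
                    (∈-cartesianProduct⁺ i∈ (∈-cartesianProduct⁺ (∈-allFin x) (∈-allFin y))) e))
  ... | inj₂ oi∈ = contradiction a<b (ℕ.<-asym (encode-level-< {y} {x}
                    (subst (opp i Fin.<_) (opp-involutive i) (lower-< oi∈))))
  edgeList-complete (between {r} {t} e) a<b = ∈-++⁺ʳ (map levelPair levelEdges)
    (∈-map⁺ hubPair (∈-filter⁺ HubEdge? (∈-cartesianProduct⁺ (∈-allFin r) (∈-allFin t)) (encode-hub-<⁻ a<b , e)))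

  edgeList-sound : ∀ {e} → e ∈ˡ edgeList → proj₁ e Fin.< proj₂ e × Adj L (proj₁ e) (proj₂ e)
  edgeList-sound e∈ with ∈-++⁻ (map levelPair levelEdges) e∈
  ... | inj₁ e∈ˡ with (i , x , y) , f∈ , refl ← ∈-map⁻ levelPair e∈ˡ
                 with ixy∈ , edge ← ∈-filter⁻ levelEdge? {xs = cartesianProduct lower positionPairs} f∈ =
    encode-level-< {x} {y} (lower-< (proj₁ (∈-cartesianProduct⁻ lower positionPairs ixy∈))) ,
    adj⁺ (opposite i edge)
  ... | inj₂ e∈ʰ with (r , t) , f∈ , refl ← ∈-map⁻ hubPair e∈ʰ
                 with _ , r<t , edge ← ∈-filter⁻ HubEdge? {xs = cartesianProduct (allFin hubs) (allFin hubs)} f∈ =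
    encode-hub-<⁺ r<t , adj⁺ (between edge)

  ∣E∣ : ∣E L ∣ ≡ edgeCount (twisted 0F) + (edgeCount (twisted 1F) + (edgeCount (twisted 2F) + 0)) + length hubEdges
  ∣E∣ = trans (length-filter-≡ (λ e → (proj₁ e <? proj₂ e) ×-dec adj? L (proj₁ e) (proj₂ e)) edgeList-unique
    (Unique.cartesianProduct⁺ (Unique.allFin⁺ u) (Unique.allFin⁺ u))
    (λ {(v , v′)} _ (v<v′ , adj) → subst (_∈ˡ edgeList) (cong₂ _,_ (encode-pointAt v) (encode-pointAt v′))
      (edgeList-complete (adj⁻ adj) (subst₂ Fin._<_ (sym (encode-pointAt v)) (sym (encode-pointAt v′)) v<v′)))
    (λ e∈ → ∈-cartesianProduct⁺ (∈-allFin _) (∈-allFin _) , edgeList-sound e∈))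
    edgeList-length

  isLower : Fin 6 → Bool
  isLower 0F = true
  isLower 1F = true
  isLower 2F = true
  isLower _  = false

  -- Differences are not symmetric in their arguments, so an edge is always read from its lower
  -- level to its upper one.
  levelColour : Bool → Bool → Fin N → Fin N → Fin w
  levelColour true  t x y = colour t x y
  levelColour false t x y = colour t y x

  isLower-opp : ∀ i → isLower (opp i) ≡ not (isLower i)
  isLower-opp = toWitness {a? = Fin.all? λ i → isLower (opp i) ≟ᵇ not (isLower i)} _

  levelColour-sym : ∀ b t x y → levelColour b t x y ≡ levelColour (not b) t y x
  levelColour-sym true  t x y = refl
  levelColour-sym false t x y = refl

  levelColour-proper : ∀ b {t x y z} → Edge t x y → Edge t x z →
                       levelColour b t x y ≡ levelColour b t x z → y ≡ z
  levelColour-proper true  e e′ eq = colour-rowUnique e e′ eq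
  levelColour-proper false e e′ eq = colour-columnUnique (edge-sym e) (edge-sym e′) eq

  pairColour : P → P → Fin w
  pairColour (at x i) (at y _) = levelColour (isLower i) (twisted i) x y
  pairColour (hub r)  (hub t)  = inject≤ (hubColour r t) 4≤w
  pairColour _        _        = zero

  pairColour-sym : ∀ {a b} → LeaveAdj a b → pairColour a b ≡ pairColour b a
  pairColour-sym (opposite {x} {y} i e) = trans (levelColour-sym (isLower i) (twisted i) x y)
    (cong₂ (λ b t → levelColour b t y x) (sym (isLower-opp i)) (sym (twisted-opp i)))
  pairColour-sym (between {r} {t} _) = cong (λ c → inject≤ c 4≤w) (hubColour-sym r t)

  pairColour-proper : ∀ {a b c} → LeaveAdj a b → LeaveAdj a c → pairColour a b ≡ pairColour a c → b ≡ c
  pairColour-proper (opposite i e) (opposite .i e′) eq =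
    cong (λ y → at y (opp i)) (levelColour-proper (isLower i) e e′ eq)
  pairColour-proper (between {r} {t} e) (between {t = v} e′) eq =
    cong hub (hubColour-proper r t v e e′ (Fin.inject≤-injective 4≤w 4≤w _ _ eq))

  colouring : EdgeColouring L w
  colouring = record
    { colour      = λ {v} {v′} _ → pairColour (pointAt v) (pointAt v′)
    ; colour-symm = λ adj _ → pairColour-sym (adj⁻ adj)
    ; proper      = λ {v} {v′} {v″} adj adj′ v′≢v″ eq → v′≢v″ (begin
        v′                  ≡⟨ encode-pointAt v′ ⟨
        encode (pointAt v′) ≡⟨ cong encode (pairColour-proper (adj⁻ adj) (adj⁻ adj′) eq) ⟩
        encode (pointAt v″) ≡⟨ encode-pointAt v″ ⟩
        v″                  ∎)
    }
    where open ≡-Reasoning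

  -- With G = L no edge remains, and the empty set of triangles is a decomposition.
  leave-decomposes : HasK₃Decomposition (L ─ L)
  leave-decomposes = [] , [] , λ _ _ (adj , ¬adj) → contradiction adj ¬adj

  -- The obstruction is applied between the levels 0 and 3, which every lawful seed twists; symmetry
  -- of the twisted graph carries the conditions on rows over to columns.
  no-decomposition : ¬ HasK₃Decomposition (L ∨ᴳ K w)
  no-decomposition = Obstruction.noDecomposition L
    (λ x → encode (at x 0F)) (λ y → encode (at y 3F)) (Edge true)
    (λ {x} {y} eq → at-injective (encode-injective {at x 0F} {at y 0F} eq))
    (λ {x} {y} eq → at-injective (encode-injective {at x 3F} {at y 3F} eq))
    (λ {x} {y} eq → contradiction (encode-injective {at x 0F} {at y 3F} eq) λ ())
    (λ {x} {v} adj → let y , eq , e = opposite⁻ (adjᵉ adj) in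
      y , sym (encode≡ eq) , subst (λ t → Edge t x y) twisted-0 e)
    (λ {y} {v} adj → let x , eq , e = opposite⁻ (adjᵉ adj) in
      x , sym (encode≡ eq) , subst (λ t → Edge t x y) (trans (twisted-opp 0F) twisted-0) (edge-sym e))
    (λ {x} {y} e → adj⁺ (opposite 0F (subst (λ t → Edge t x y) (sym twisted-0) e)))
    o p q (λ ())
    (λ x x≢o → let f , edge , _ = twisted-row x x≢o in f , edge)
    (λ y y≢o → let f , edge , _ = twisted-row y y≢o in f , λ x x≢f → edge-sym (edge x x≢f))
    (λ { (far o≢y ¬t) → (o≢y ∘ sym) , λ { refl → ¬t o-p } })
    (λ x x≢o x≢p x≢q → far x≢o λ { p-o → x≢p refl ; q-o → x≢q refl })

-- The numerical conditions and the choice of seed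

open import Data.Integer using (ℤ; +_; 0ℤ)

2*nC2 : ∀ n → 2 * (suc n C 2) ≡ suc n * n
2*nC2 zero    = refl
2*nC2 (suc n) = begin
  2 * (suc (suc n) C 2)             ≡⟨ cong (2 *_) (nCk+nC[k+1]≡[n+1]C[k+1] (suc n) 1) ⟨
  2 * (suc n C 1 + suc n C 2)       ≡⟨ cong (λ m → 2 * (m + suc n C 2)) (nC1≡n (suc n)) ⟩
  2 * (suc n + suc n C 2)           ≡⟨ ℕ.*-distribˡ-+ 2 (suc n) (suc n C 2) ⟩
  2 * suc n + 2 * (suc n C 2)       ≡⟨ cong (λ m → 2 * suc n + m) (2*nC2 n) ⟩
  2 * suc n + suc n * n             ≡⟨ identity n ⟩
  suc (suc n) * suc n               ∎
  where
  open ≡-Reasoning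
  identity : ∀ n → 2 * suc n + suc n * n ≡ suc (suc n) * suc n
  identity = solve-∀

evenC2 : ∀ h → (suc h * 2) C 2 ≡ suc h * suc (h * 2)
evenC2 h = ℕ.*-cancelˡ-≡ _ _ 2 (trans (2*nC2 (suc (h * 2))) (identity h))
  where
  identity : ∀ h → suc h * 2 * suc (h * 2) ≡ 2 * (suc h * suc (h * 2))
  identity = solve-∀

edgeBound : ∀ u w e → (u + 1) * w ≤ w * w + 2 * e →
  (+ w) ℤ.^ 2 ℤ.- (+ (u + 1)) ℤ.* (+ w) ℤ.+ (+ 2) ℤ.* (+ e) ℤ.≥ 0ℤ
edgeBound u w e bound = subst (0ℤ ℤ.≤_) (sym rearranged) (ℤ.i≤j⇒0≤j-i (ℤ.+≤+ bound))
  where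
  open ≡-Reasoning
  rearranged : (+ w) ℤ.^ 2 ℤ.- (+ (u + 1)) ℤ.* (+ w) ℤ.+ (+ 2) ℤ.* (+ e) ≡
               + (w * w + 2 * e) ℤ.- + ((u + 1) * w)
  rearranged = begin
    (+ w) ℤ.^ 2 ℤ.- (+ (u + 1)) ℤ.* (+ w) ℤ.+ (+ 2) ℤ.* (+ e)
      ≡⟨ cong₂ (λ a b → (+ w) ℤ.* a ℤ.- b ℤ.+ (+ 2) ℤ.* (+ e)) (ℤ.*-identityʳ (+ w)) (sym (ℤ.pos-* (u + 1) w)) ⟩
    (+ w) ℤ.* (+ w) ℤ.- + ((u + 1) * w) ℤ.+ (+ 2) ℤ.* (+ e)
      ≡⟨ cong₂ (λ a b → a ℤ.- + ((u + 1) * w) ℤ.+ b) (sym (ℤ.pos-* w w)) (sym (ℤ.pos-* 2 e)) ⟩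
    + (w * w) ℤ.- + ((u + 1) * w) ℤ.+ + (2 * e)
      ≡⟨ ℤ.+-assoc (+ (w * w)) (ℤ.- + ((u + 1) * w)) (+ (2 * e)) ⟩
    + (w * w) ℤ.+ (ℤ.- + ((u + 1) * w) ℤ.+ + (2 * e))
      ≡⟨ cong (λ a → + (w * w) ℤ.+ a) (ℤ.+-comm (ℤ.- + ((u + 1) * w)) (+ (2 * e))) ⟩
    + (w * w) ℤ.+ (+ (2 * e) ℤ.- + ((u + 1) * w))
      ≡⟨ ℤ.+-assoc (+ (w * w)) (+ (2 * e)) (ℤ.- + ((u + 1) * w)) ⟨
    + (w * w) ℤ.+ + (2 * e) ℤ.- + ((u + 1) * w)
      ≡⟨ cong (λ a → a ℤ.- + ((u + 1) * w)) (ℤ.pos-+ (w * w) (2 * e)) ⟨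
    + (w * w + 2 * e) ℤ.- + ((u + 1) * w) ∎

Counterexample : ℕ → Set₁
Counterexample w =
  Σ[ u ∈ ℕ ] Σ[ P ∈ PartialSTS u ]
    ( (∀ x → deg (leave P) x % 2 ≡ w % 2)
    × (w > 0 → (u + w) % 2 ≡ 1)
    × (∣E leave P ∣ + u * w + (w C 2)) % 3 ≡ 0
    × (Σ[ G ∈ Graph u ]
        ( G ⊆ᴳ leave P
        × HasK₃Decomposition (leave P ─ G)
        × (+ w) ℤ.^ 2 ℤ.- (+ (u + 1)) ℤ.* (+ w) ℤ.+ (+ 2) ℤ.* (+ ∣E G ∣) ℤ.≥ 0ℤ
        × EdgeColouring G w ))
    × ¬ HasK₃Decomposition (leave P ∨ᴳ K w) )

module Conclusion (h : ℕ) (seed : SeedData) (lawful : SeedData.Lawful seed) (4≤w : 4 ≤ suc h * 2) where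
  open Assembly h seed lawful 4≤w
  open SeedData seed using (hubs)
  open Residues h using (w; N)

  -- The numbers j, q, d witness that the number of hubs is odd, that the sum in (3) is a multiple
  -- of 3, and that (ii) holds with slack d.
  counterexample : ∀ {e} j q d → ∣E L ∣ ≡ e → hubs ≡ 1 + j * 2 →
    e + u * w + suc h * suc (h * 2) ≡ q * 3 → (u + 1) * w + d ≡ w * w + 2 * e → Counterexample w
  counterexample j q d refl hubs≡ mod3 bound =
    u , system ,
    (λ x → trans (deg-even x) (sym (m*n%n≡0 (suc h) 2))) ,
    (λ _ → trans (cong (_% 2) u+w-odd) ([m+kn]%n≡m%n 1 (3 * N + j + suc h) 2)) ,
    trans (cong (_% 3) (trans (cong (λ c → ∣E L ∣ + u * w + c) (evenC2 h)) mod3)) (m*n%n≡0 q 3) ,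
    (L , id , leave-decomposes ,
      edgeBound u w ∣E L ∣ (subst ((u + 1) * w ≤_) bound (ℕ.m≤m+n _ d)) ,
      colouring) ,
    no-decomposition
    where
    identity : ∀ n j h → 6 * n + (1 + j * 2) + suc h * 2 ≡ 1 + (3 * n + j + suc h) * 2
    identity = solve-∀
    u+w-odd : u + w ≡ 1 + (3 * N + j + suc h) * 2
    u+w-odd = trans (cong (λ s → 6 * N + s + w) hubs≡) (identity N j h)

4≤[2+k]*2 : ∀ k → 4 ≤ suc (suc k) * 2
4≤[2+k]*2 k = s≤s (s≤s (s≤s (s≤s z≤n)))

-- Here w = 6(m + 1), and the slack in (ii) is w² - 2w - 12.
counterexample₁ : ∀ m → Counterexample (suc (suc (1 + m * 3)) * 2)
counterexample₁ m = Conclusion.counterexample h seed₁ lawful₁ 4≤w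
  0 quotient (36 * m * m + 60 * m + 12) (Assembly.∣E∣ h seed₁ lawful₁ 4≤w) refl (mod3 m) (bound m)
  where
  h w quotient : ℕ
  h = 2 + m * 3
  w = suc h * 2
  -- The thirds of the edge number, of 6Nw, of w and of the binomial coefficient, in this order.
  quotient = h * 2 + w * w + 2 * suc w * w + 2 * (1 + m) + (1 + m) * (5 + 6 * m)
  4≤w = 4≤[2+k]*2 (1 + m * 3)
  mod3 : ∀ m → let h = 2 + m * 3 ; w = suc h * 2 ; e = h * 2 + w * w in
    e + (e + (e + 0)) + 0 + (6 * suc w + 1) * w + suc h * suc (h * 2) ≡
    (h * 2 + w * w + 2 * suc w * w + 2 * (1 + m) + (1 + m) * (5 + 6 * m)) * 3
  mod3 = solve-∀
  bound : ∀ m → let h = 2 + m * 3 ; w = suc h * 2 ; e = h * 2 + w * w in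
    (6 * suc w + 1 + 1) * w + (36 * m * m + 60 * m + 12) ≡ w * w + 2 * (e + (e + (e + 0)) + 0)
  bound = solve-∀

-- The summand 6 counts the edges among the hubs. With w = 2k + 4 the slack in (ii) is (w - 2)(w -
-- 4), which vanishes at w = 4.
counterexample₅ : ∀ k q → (let h = suc k ; w = suc h * 2 ; e = h * 2 + w * w + (suc w * w + (suc w * w + 0)) + 6 in
  e + (6 * suc w + 5) * w + suc h * suc (h * 2) ≡ q * 3) → Counterexample (suc (suc k) * 2)
counterexample₅ k q mod3 = Conclusion.counterexample (suc k) seed₅ lawful₅ 4≤w
  2 q (4 * k * k + 4 * k) (Assembly.∣E∣ (suc k) seed₅ lawful₅ 4≤w) refl mod3 (bound k)
  where
  4≤w = 4≤[2+k]*2 k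
  bound : ∀ k → let h = suc k ; w = suc h * 2 ; e = h * 2 + w * w + (suc w * w + (suc w * w + 0)) + 6 in
    (6 * suc w + 5 + 1) * w + (4 * k * k + 4 * k) ≡ w * w + 2 * e
  bound = solve-∀

-- The number of vertices forces seed₁ or seed₅ through the condition modulo 3:
-- seed₁ admits w ≡ 0, 2 and seed₅ admits w ≡ 2, 4 modulo 6.
counterexampleFor : ∀ k → Counterexample (suc (suc k) * 2)
counterexampleFor k with k divMod 3
-- The three remainders of k give w = 6m + 4, 6m + 6 and 6m + 8.
... | result m 0F refl = counterexample₅ k (114 * m * m + 179 * m + 70) (mod3 m)
  where
  mod3 : ∀ m → let h = suc (m * 3) ; w = suc h * 2 ; e = h * 2 + w * w + (suc w * w + (suc w * w + 0)) + 6 in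
    e + (6 * suc w + 5) * w + suc h * suc (h * 2) ≡ (114 * m * m + 179 * m + 70) * 3
  mod3 = solve-∀
... | result m 1F refl = counterexample₁ m
... | result m 2F refl = counterexample₅ k (114 * m * m + 331 * m + 240) (mod3 m)
  where
  mod3 : ∀ m → let h = suc (2 + m * 3) ; w = suc h * 2 ; e = h * 2 + w * w + (suc w * w + (suc w * w + 0)) + 6 in
    e + (6 * suc w + 5) * w + suc h * suc (h * 2) ≡ (114 * m * m + 331 * m + 240) * 3
  mod3 = solve-∀

theorem3 : ∀ (w : ℕ) → 2 ∣ w → 4 ≤ w →
  Σ[ u ∈ ℕ ] Σ[ P ∈ PartialSTS u ]
    ( (∀ x → deg (leave P) x % 2 ≡ w % 2)
    × (w > 0 → (u + w) % 2 ≡ 1)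
    × (∣E leave P ∣ + u * w + (w C 2)) % 3 ≡ 0
    × (Σ[ G ∈ Graph u ]
        ( G ⊆ᴳ leave P
        × HasK₃Decomposition (leave P ─ G)
        × (+ w) ℤ.^ 2 ℤ.- (+ (u + 1)) ℤ.* (+ w) ℤ.+ (+ 2) ℤ.* (+ ∣E G ∣) ℤ.≥ 0ℤ
        × EdgeColouring G w ))
    × ¬ HasK₃Decomposition (leave P ∨ᴳ K w) )
theorem3 _ (divides zero refl) ()
theorem3 _ (divides (suc zero) refl) (s≤s (s≤s ()))
theorem3 _ (divides (suc (suc k)) refl) _ = counterexampleFor k
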